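{- Let $4.2$ denote the $3$-graph on $4$ vertices with exactly $2$ edges, let $C_5$ be the $3$-graph on $\{1,\dots,5\}$ with edges $123,234,345,451,512$, and let $F_{3,2}$ be the $3$-graph on $\{1,\dots,5\}$ with edges $123,124,125,345$. Then \[\pi_{4.2}(\{C_5,F_{3,2}\})=\frac{9}{16}.\]
   Context: A $3$-graph is a pair $G=(V,E)$ with $E$ a set of $3$-element subsets of $V$. For a $3$-graph $H$ on $h$ vertices and a $3$-graph $G$ on $n\ge h$ vertices, $e_H(G)$ is the number of $h$-subsets of $V(G)$ inducing a subgraph isomorphic to $H$. For a family $\mathcal{F}$ of $3$-graphs, $G$ is $\mathcal{F}$-free if it contains no member of $\mathcal{F}$ as a (not necessarily induced) subgraph. $\mathrm{ex}_H(n,\mathcal{F})$ is the maximum of $e_H(G)$ over $\mathcal{F}$-free $G$ on $n$ vertices, and $\pi_H(\mathcal{F})=\lim_{n\to\infty}\mathrm{ex}_H(n,\mathcal{F})/\binom{n}{h}$ (the limit exists). -}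

module Defs where

open import Data.Nat using (ℕ; zero; suc; _≡ᵇ_)
open import Data.Bool using (Bool; true; false; _∧_)
open import Data.Fin using (Fin; zero; suc)
open import Data.Fin.Subset using (Subset; ⁅_⁆; _∪_; ∣_∣)
open import Data.Vec using ([]; _∷_)
open import Data.List using (List; []; _∷_; _++_; map; length; filterᵇ)
open import Data.List.Relation.Unary.All using (All)
open import Data.Product using (Σ; _×_; _,_; ∃-syntax)
open import Relation.Binary.PropositionalEquality using (_≡_)
open import Relation.Nullary using (¬_)
open import Function.Definitions using (Injective)

-- A 3-graph on vertex set Fin n: its edge set is the set of 3-element
-- subsets T (i.e. ∣ T ∣ ≡ 3) with E T ≡ true.  Values of E on subsets of
-- other sizes are irrelevant (never inspected).
Graph3 : ℕ → Set
Graph3 n = Subset n → Bool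

allSubsets : (n : ℕ) → List (Subset n)
allSubsets zero = [] ∷ []
allSubsets (suc n) = map (false ∷_) (allSubsets n) ++ map (true ∷_) (allSubsets n)

_⊆ᵇ_ : ∀ {n} → Subset n → Subset n → Bool
[] ⊆ᵇ [] = true
(false ∷ s) ⊆ᵇ (_ ∷ t) = s ⊆ᵇ t
(true ∷ s) ⊆ᵇ (b ∷ t) = b ∧ (s ⊆ᵇ t)

edgesIn : ∀ {n} → Graph3 n → Subset n → ℕ
edgesIn {n} G S = length (filterᵇ (λ T → (∣ T ∣ ≡ᵇ 3) ∧ ((T ⊆ᵇ S) ∧ G T)) (allSubsets n))

-- e_{4.2}(G): number of 4-subsets of V(G) inducing a copy of 4.2,
-- i.e. spanning exactly 2 edges (every 3-graph on 4 vertices with exactly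
-- 2 edges is, by definition of 4.2, a copy of 4.2).
e42 : ∀ {n} → Graph3 n → ℕ
e42 {n} G = length (filterᵇ (λ S → (∣ S ∣ ≡ᵇ 4) ∧ (edgesIn G S ≡ᵇ 2)) (allSubsets n))

-- A small 3-graph given by its number of vertices and list of edges (triples
-- of distinct vertices).
record Pattern : Set where
  field
    verts : ℕ
    edges : List (Fin verts × Fin verts × Fin verts)
open Pattern public

triple : ∀ {n} → Fin n → Fin n → Fin n → Subset n
triple a b c = ⁅ a ⁆ ∪ (⁅ b ⁆ ∪ ⁅ c ⁆)

Contains : ∀ {n} → Graph3 n → Pattern → Set
Contains {n} G F =
  Σ (Fin (verts F) → Fin n) λ f → Injective _≡_ _≡_ f ×
    All (λ { (a , b , c) → G (triple (f a) (f b) (f c)) ≡ true }) (edges F)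

v1 v2 v3 v4 v5 : Fin 5
v1 = zero
v2 = suc zero
v3 = suc (suc zero)
v4 = suc (suc (suc zero))
v5 = suc (suc (suc (suc zero)))

C5 : Pattern
C5 = record { verts = 5
            ; edges = (v1 , v2 , v3) ∷ (v2 , v3 , v4) ∷ (v3 , v4 , v5)
                    ∷ (v4 , v5 , v1) ∷ (v5 , v1 , v2) ∷ [] }

F32 : Pattern
F32 = record { verts = 5
             ; edges = (v1 , v2 , v3) ∷ (v1 , v2 , v4) ∷ (v1 , v2 , v5)
                     ∷ (v3 , v4 , v5) ∷ [] }

Free : ∀ {n} → Graph3 n → Set
Free G = ¬ Contains G C5 × ¬ Contains G F32

{-# OPTIONS --safe #-}
module Submission where

-- In C5 and in F32 any two vertices lie in a common edge, so a blow-up of a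
-- free graph is free and one may sample vertices with repetition: sums over
-- all ordered tuples carry no error terms.  The upper bound is a flag-algebra
-- sum of squares on five vertices.  Adding squares of sums over one or two
-- vertices to the number of induced copies of 4.2 turns the bound into a
-- pointwise inequality, averaged over the orderings of five vertices, which is
-- checked on all 2^10 graphs on five vertices.  The lower bound comes from the
-- balanced blow-up of the complete 3-graph on four vertices: no colouring of
-- C5 or F32 with four colours makes every edge rainbow.

open import Defs
import Algebra.Properties.Semiring.Sum as SemiringSum
open import Data.Bool using (Bool; true; false; _∧_; _∨_; if_then_else_; T)
open import Data.Bool.Properties using (∧-zeroʳ; ¬-not; not-¬) renaming (_≟_ to _≟ᵇ_)
open import Data.Fin using (Fin; zero; suc)
open import Data.Fin.Properties using (all?)
open import Data.Fin.Subset using (Subset; ⊥; ⊤; ⁅_⁆; _∪_; ∣_∣)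
open import Data.Fin.Subset.Properties using (∪-identityˡ; ∪-comm; ∪-assoc; ∪-idem; ∣⁅x⁆∣≡1)
open import Data.Integer as ℤ using (ℤ; +_; -[1+_]; +≤+)
import Data.Integer.Properties as ℤ
import Data.Integer.Tactic.RingSolver as ℤSolver
open import Data.List using (List; []; _∷_; _++_; map; length; filterᵇ)
open import Data.List.Relation.Unary.All using ([]; _∷_)
open import Data.Nat as ℕ using (ℕ; zero; suc; _+_; _*_; _≤_; _≡ᵇ_; _!; z≤n; s≤s; s≤s⁻¹; _/_; _%_)
open import Data.Nat.Combinatorics using (_C_; nCk+nC[k+1]≡[n+1]C[k+1]; nC1≡n)
open import Data.Nat.DivMod using (m≡m%n+[m/n]*n; m%n<n)
import Data.Nat.Properties as ℕ
open import Data.Nat.Tactic.RingSolver using (solve-∀)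
open import Data.Product using (_×_; _,_; proj₂; ∃-syntax; Σ-syntax)
open import Data.Unit using (tt) renaming (⊤ to Unit)
open import Data.Vec using (lookup; []; _∷_; _[_]≔_)
open import Data.Vec.Properties using (lookup-replicate)
open import Data.Vec.Relation.Unary.All using ([]; _∷_)
open import Data.Vec.Relation.Unary.AllPairs using ([]; _∷_)
open import Data.Vec.Relation.Unary.Unique.Propositional using (Unique)
open import Data.Vec.Relation.Unary.Unique.Propositional.Properties using (lookup-injective)
open import Function using (_∘_)
open import Relation.Binary.PropositionalEquality
open import Relation.Nullary using (¬_)
open import Relation.Nullary.Decidable using (toWitness)

-- The obstacle is the passage from five-vertex graphs to five-tuples of vertices of a large graph.
-- Such a tuple may repeat vertices, yet `pullback` along it is still a 3-graph on `Fin 5`, in which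
-- repeated vertices become twins. So one finite check covers degenerate tuples as well, and the
-- squares may be summed over all tuples, where they factor exactly. Errors enter in three places
-- only: quadruples with repeated entries, `n * n * n * n` against `24 * (n C 4)`, and the remainder
-- of `n` modulo 4. Each is of order `n * n * n`, and `cube-negligible` absorbs it. The limit is
-- stated with accuracy `1 / suc k` and denominators cleared. Lower bounds in ℕ are kept free of
-- subtraction by moving the negative terms to the other side.

module ℤΣ = SemiringSum ℤ.+-*-semiring
module ℕΣ = SemiringSum ℕ.+-*-semiring
open ℤΣ using () renaming (sum to ∑ℤ)
open ℕΣ using () renaming (sum to ∑)

-- The certificate

Triples : Set → Set
Triples V = V → V → V → Bool

FiveAry : Set → Set → Set
FiveAry V A = V → V → V → V → V → A

-- The transpositions (i k) with i ≤ k represent the cosets of Sₖ₋₁ in Sₖ, so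
-- symm combines all 120 reorderings of the arguments.
module Symmetrise {A : Set} (_∙_ : A → A → A) where

  sym₂ sym₃ sym₄ sym₅ symm : ∀ {V} → FiveAry V A → FiveAry V A
  sym₂ F a b c d e = F a b c d e ∙ F b a c d e
  sym₃ F a b c d e = F a b c d e ∙ (F a c b d e ∙ F c b a d e)
  sym₄ F a b c d e = F a b c d e ∙ (F a b d c e ∙ (F a d c b e ∙ F d b c a e))
  sym₅ F a b c d e =
    F a b c d e ∙ (F a b c e d ∙ (F a b e d c ∙ (F a e c d b ∙ F e b c d a)))
  symm F = sym₅ (sym₄ (sym₃ (sym₂ F)))

open Symmetrise ℤ._+_ using (sym₂; sym₃; sym₄; sym₅) renaming (symm to symℤ)
open Symmetrise _∨_ using () renaming (symm to sym∨)

module _ {V : Set} (E : Triples V) where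

  c5 f32 : FiveAry V Bool
  c5 a b c d e = E a b c ∧ (E b c d ∧ (E c d e ∧ (E d e a ∧ E e a b)))
  f32 a b c d e = E a b c ∧ (E a b d ∧ (E a b e ∧ E c d e))

bit : Bool → ℕ
bit b = if b then 1 else 0

two : Bool → Bool → Bool → Bool → ℕ
two p q r s = bit (bit p + (bit q + (bit r + bit s)) ≡ᵇ 2)

twoEdges : ∀ {V} → Triples V → V → V → V → V → ℕ
twoEdges E a b c d = two (E a b c) (E a b d) (E a c d) (E b c d)

-- The weights below make every squared sum vanish on the balanced blow-up of
-- the complete 3-graph on four vertices, as a sharp certificate requires; for
-- instance, links there have density 3/8, and 3·5/8 - 5·3/8 = 0.
edgeDefect : Bool → ℤ
edgeDefect true = -[1+ 4 ]
edgeDefect false = + 3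

difference : Bool → Bool → ℤ
difference true false = + 1
difference false true = -[1+ 0 ]
difference _ _ = + 0

-- The arguments say which pairs of an edge form an edge with a further vertex `c`. In the extremal
-- blow-up a `c` in the fourth class gives three edges, and a `c` in the class of a root gives
-- exactly one; the total over equal classes is 3 - 1 - 1 - 1 = 0.
agreement : Bool → Bool → Bool → ℤ
agreement true true true = + 3
agreement false false false = + 3
agreement _ _ _ = -[1+ 0 ]

-- Terms of squares whose type is the root triple, an edge or a non-edge. `difference` is
-- antisymmetric in two of the roots; symmetrisation supplies the other pairs of roots. For a
-- non-edge only those `c` count that form exactly one edge with the roots. In the extremal blow-up
-- two roots of a non-edge are twins, so `c` forms none or two, and every term vanishes.
flagPair : Bool → (x y z x′ y′ z′ : Bool) → ℤ
flagPair true x y z x′ y′ z′ =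
  + 16 ℤ.* (agreement x y z ℤ.* agreement x′ y′ z′) ℤ.+
  + 192 ℤ.* (difference x y ℤ.* difference x′ y′)
flagPair false x y z x′ y′ z′ =
  + 288 ℤ.* ((if z then + 0 else difference x y) ℤ.* (if z′ then + 0 else difference x′ y′))

module _ {V : Set} (E : Triples V) where

  target vertexFlags tripleFlags certificate : FiveAry V ℤ
  target r a b c d = + 144 ℤ.* + twoEdges E r a b c
  vertexFlags r a b c d = + 9 ℤ.* (edgeDefect (E r a b) ℤ.* edgeDefect (E r c d))
  tripleFlags r a b c d =
    flagPair (E r a b) (E r a c) (E r b c) (E a b c) (E r a d) (E r b d) (E a b d)
  certificate r a b c d = target r a b c d ℤ.+ (vertexFlags r a b c d ℤ.+ tripleFlags r a b c d)

-- A k-graph on suc n vertices is the link of its first vertex, a (k-1)-graph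
-- on the remaining n vertices, together with the k-graph induced on these.
Code : ℕ → ℕ → Set
Code zero n = Bool
Code (suc k) zero = Unit
Code (suc k) (suc n) = Code k n × Code (suc k) n

every : ∀ k n → (Code k n → Bool) → Bool
every zero n p = p true ∧ p false
every (suc k) zero p = p tt
every (suc k) (suc n) p = every k n (λ g → every (suc k) n (λ h → p (g , h)))

decode₁ : ∀ {n} → Code 1 n → Fin n → Bool
decode₁ (g , h) zero = g
decode₁ (g , h) (suc i) = decode₁ h i

decode₂ : ∀ {n} → Code 2 n → Fin n → Fin n → Bool
decode₂ (g , h) zero zero = false
decode₂ (g , h) zero (suc j) = decode₁ g j
decode₂ (g , h) (suc i) zero = decode₁ g i
decode₂ (g , h) (suc i) (suc j) = decode₂ h i j

decode₃ : ∀ {n} → Code 3 n → Triples (Fin n)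
decode₃ (g , h) zero zero k = false
decode₃ (g , h) zero (suc j) zero = false
decode₃ (g , h) zero (suc j) (suc k) = decode₂ g j k
decode₃ (g , h) (suc i) zero zero = false
decode₃ (g , h) (suc i) zero (suc k) = decode₂ g i k
decode₃ (g , h) (suc i) (suc j) zero = decode₂ g i j
decode₃ (g , h) (suc i) (suc j) (suc k) = decode₃ h i j k

-- 9720 = 120 · 81, and 81/144 = 9/16.
hasForbidden boundHolds : Triples (Fin 5) → Bool
hasForbidden E = sym∨ (c5 E) v1 v2 v3 v4 v5 ∨ sym∨ (f32 E) v1 v2 v3 v4 v5
boundHolds E = symℤ (certificate E) v1 v2 v3 v4 v5 ℤ.≤ᵇ + 9720

forbiddenOrBounded : Code 3 5 → Bool
forbiddenOrBounded g = hasForbidden (decode₃ g) ∨ boundHolds (decode₃ g)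

-- `Code 3 5` consists of ten bits, so this evaluates 1024 cases. Labelled graphs are enumerated
-- rather than isomorphism classes, which spares an isomorphism argument.
certified : every 3 5 forbiddenOrBounded ≡ true
certified = refl

every-sound : ∀ k n (p : Code k n → Bool) → every k n p ≡ true → ∀ g → p g ≡ true
every-sound zero n p eq true with p true | eq
... | true | _ = refl
every-sound zero n p eq false with p true | p false | eq
... | true | true | _ = refl
every-sound (suc k) zero p eq tt = eq
every-sound (suc k) (suc n) p eq (g , h) =
  every-sound (suc k) n _ (every-sound k n _ eq g) h

encode₁ : ∀ {n} → (Fin n → Bool) → Code 1 n
encode₁ {zero} f = tt
encode₁ {suc n} f = f zero , encode₁ (f ∘ suc)

encode₂ : ∀ {n} → (Fin n → Fin n → Bool) → Code 2 n
encode₂ {zero} f = tt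
encode₂ {suc n} f = encode₁ (f zero ∘ suc) , encode₂ (λ i j → f (suc i) (suc j))

encode₃ : ∀ {n} → Triples (Fin n) → Code 3 n
encode₃ {zero} f = tt
encode₃ {suc n} f =
  encode₂ (λ i j → f zero (suc i) (suc j)) , encode₃ (λ i j k → f (suc i) (suc j) (suc k))

record IsGraph {V : Set} (E : Triples V) : Set where
  field
    swap₁₂ : ∀ a b c → E a b c ≡ E b a c
    swap₂₃ : ∀ a b c → E a b c ≡ E a c b
    irrefl : ∀ a b → E a a b ≡ false

  irrefl₂₃ : ∀ a b → E b a a ≡ false
  irrefl₂₃ a b = trans (swap₁₂ b a a) (trans (swap₂₃ a b a) (irrefl a b))

  irrefl₁₃ : ∀ a b → E a b a ≡ false
  irrefl₁₃ a b = trans (swap₂₃ a b a) (irrefl a b)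

-- Vertices identified by `v` lie in no common edge, by `irrefl`, and have equal links. Stating
-- `IsGraph` for triples instead of 3-sets makes this work for maps that are not injective.
pullback : ∀ {U V : Set} (v : U → V) {E : Triples V} →
           IsGraph E → IsGraph (λ i j k → E (v i) (v j) (v k))
pullback v G = record
  { swap₁₂ = λ a b c → swap₁₂ (v a) (v b) (v c)
  ; swap₂₃ = λ a b c → swap₂₃ (v a) (v b) (v c)
  ; irrefl = λ a b → irrefl (v a) (v b) }
  where open IsGraph G

decode-encode₁ : ∀ {n} (f : Fin n → Bool) i → decode₁ (encode₁ f) i ≡ f i
decode-encode₁ f zero = refl
decode-encode₁ f (suc i) = decode-encode₁ (f ∘ suc) i

decode-encode₂ : ∀ {n} (f : Fin n → Fin n → Bool) →
                 (∀ i j → f i j ≡ f j i) → (∀ i → f i i ≡ false) →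
                 ∀ i j → decode₂ (encode₂ f) i j ≡ f i j
decode-encode₂ f s r zero zero = sym (r zero)
decode-encode₂ f s r zero (suc j) = decode-encode₁ (f zero ∘ suc) j
decode-encode₂ f s r (suc i) zero =
  trans (decode-encode₁ (f zero ∘ suc) i) (s zero (suc i))
decode-encode₂ f s r (suc i) (suc j) =
  decode-encode₂ (λ i j → f (suc i) (suc j)) (λ i j → s (suc i) (suc j)) (r ∘ suc) i j

decode-encode₃ : ∀ {n} (f : Triples (Fin n)) → IsGraph f →
                 ∀ i j k → decode₃ (encode₃ f) i j k ≡ f i j k
decode-encode₃ {suc n} f G = go
  where
  open IsGraph G
  link : ∀ j k → decode₂ (encode₂ (λ i j → f zero (suc i) (suc j))) j k ≡ f zero (suc j) (suc k)
  link = decode-encode₂ _ (λ i j → swap₂₃ zero (suc i) (suc j)) (λ i → irrefl₂₃ (suc i) zero)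
  go : ∀ i j k → decode₃ (encode₃ f) i j k ≡ f i j k
  go zero zero k = sym (irrefl zero k)
  go zero (suc j) zero = sym (irrefl₁₃ zero (suc j))
  go zero (suc j) (suc k) = link j k
  go (suc i) zero zero = sym (irrefl₂₃ zero (suc i))
  go (suc i) zero (suc k) = trans (link i k) (swap₁₂ zero (suc i) (suc k))
  go (suc i) (suc j) zero =
    trans (link i j) (trans (swap₁₂ zero (suc i) (suc j)) (swap₂₃ (suc i) zero (suc j)))
  go (suc i) (suc j) (suc k) = decode-encode₃ _ (pullback suc G) i j k

module _ {A : Set} (_∙_ : A → A → A) {V : Set} {F H : FiveAry V A}
         (eq : ∀ a b c d e → F a b c d e ≡ H a b c d e) where
  open Symmetrise _∙_ using () renaming (sym₂ to s₂; sym₃ to s₃; sym₄ to s₄; sym₅ to s₅; symm to s)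

  -- Decoding an encoded graph returns it only pointwise; this carries such an equality through all
  -- reorderings.
  symm-cong : ∀ a b c d e → s F a b c d e ≡ s H a b c d e
  symm-cong = cong₅ (cong₄ (cong₃ (cong₂′ eq)))
    where
    cong₂′ : ∀ {F H : FiveAry V A} → (∀ a b c d e → F a b c d e ≡ H a b c d e) →
             ∀ a b c d e → s₂ F a b c d e ≡ s₂ H a b c d e
    cong₂′ eq a b c d e = cong₂ _∙_ (eq _ _ _ _ _) (eq _ _ _ _ _)
    cong₃ : ∀ {F H : FiveAry V A} → (∀ a b c d e → F a b c d e ≡ H a b c d e) →
            ∀ a b c d e → s₃ F a b c d e ≡ s₃ H a b c d e
    cong₃ eq a b c d e =
      cong₂ _∙_ (eq _ _ _ _ _) (cong₂ _∙_ (eq _ _ _ _ _) (eq _ _ _ _ _))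
    cong₄ : ∀ {F H : FiveAry V A} → (∀ a b c d e → F a b c d e ≡ H a b c d e) →
            ∀ a b c d e → s₄ F a b c d e ≡ s₄ H a b c d e
    cong₄ eq a b c d e =
      cong₂ _∙_ (eq _ _ _ _ _)
        (cong₂ _∙_ (eq _ _ _ _ _) (cong₂ _∙_ (eq _ _ _ _ _) (eq _ _ _ _ _)))
    cong₅ : ∀ {F H : FiveAry V A} → (∀ a b c d e → F a b c d e ≡ H a b c d e) →
            ∀ a b c d e → s₅ F a b c d e ≡ s₅ H a b c d e
    cong₅ eq a b c d e =
      cong₂ _∙_ (eq _ _ _ _ _) (cong₂ _∙_ (eq _ _ _ _ _)
        (cong₂ _∙_ (eq _ _ _ _ _) (cong₂ _∙_ (eq _ _ _ _ _) (eq _ _ _ _ _))))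

-- Reordering arguments commutes with relabelling them. A claim about any five vertices thereby
-- becomes one about `v1`, ..., `v5` in a pulled-back graph.
symm-natural : ∀ {A U V : Set} (_∙_ : A → A → A) (v : U → V) (F : FiveAry V A) → ∀ a b c d e →
               Symmetrise.symm _∙_ F (v a) (v b) (v c) (v d) (v e) ≡
               Symmetrise.symm _∙_ (λ a b c d e → F (v a) (v b) (v c) (v d) (v e)) a b c d e
symm-natural _∙_ v F a b c d e = refl

certificate-cong : ∀ {V} {E E′ : Triples V} → (∀ i j k → E i j k ≡ E′ i j k) →
                   ∀ a b c d e → certificate E a b c d e ≡ certificate E′ a b c d e
certificate-cong eq a b c d e
  rewrite eq a b c | eq a b d | eq a c d | eq b c d | eq a d e | eq a b e | eq b c e | eq a c e
  = refl

c5-cong : ∀ {V} {E E′ : Triples V} → (∀ i j k → E i j k ≡ E′ i j k) →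
          ∀ a b c d e → c5 E a b c d e ≡ c5 E′ a b c d e
c5-cong eq a b c d e
  rewrite eq a b c | eq b c d | eq c d e | eq d e a | eq e a b = refl

f32-cong : ∀ {V} {E E′ : Triples V} → (∀ i j k → E i j k ≡ E′ i j k) →
           ∀ a b c d e → f32 E a b c d e ≡ f32 E′ a b c d e
f32-cong eq a b c d e
  rewrite eq a b c | eq a b d | eq a b e | eq c d e = refl

certified-graph : (E : Triples (Fin 5)) → IsGraph E →
                  (∀ a b c d e → c5 E a b c d e ≡ false) →
                  (∀ a b c d e → f32 E a b c d e ≡ false) →
                  symℤ (certificate E) v1 v2 v3 v4 v5 ℤ.≤ + 9720
certified-graph E G noC5 noF32 =
  subst (ℤ._≤ + 9720) (symm-cong ℤ._+_ (certificate-cong eq) v1 v2 v3 v4 v5)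
    (ℤ.≤ᵇ⇒≤ {symℤ (certificate E′) v1 v2 v3 v4 v5} {+ 9720} (subst T (sym bound) tt))
  where
  E′ = decode₃ (encode₃ E)
  eq : ∀ i j k → E′ i j k ≡ E i j k
  eq = decode-encode₃ E G
  none : hasForbidden E′ ≡ false
  none = cong₂ _∨_
    -- Symmetrising the constant `false` computes to `false`, so it is enough that no single
    -- ordering gives a copy.
    (symm-cong _∨_ {H = λ _ _ _ _ _ → false}
      (λ a b c d e → trans (c5-cong eq a b c d e) (noC5 a b c d e)) v1 v2 v3 v4 v5)
    (symm-cong _∨_ {H = λ _ _ _ _ _ → false}
      (λ a b c d e → trans (f32-cong eq a b c d e) (noF32 a b c d e)) v1 v2 v3 v4 v5)
  bound : boundHolds E′ ≡ true
  bound = trans (cong (_∨ boundHolds E′) (sym none))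
    (every-sound 3 5 forbiddenOrBounded certified (encode₃ E))

-- Sums over tuples of vertices

∑-cong : ∀ {n} {f g : Fin n → ℕ} → (∀ i → f i ≡ g i) → ∑ f ≡ ∑ g
∑-cong {n} {f} {g} = ℕΣ.sum-cong-≗ {n} {f} {g}

∑-zero : ∀ n → ∑ {n} (λ _ → 0) ≡ 0
∑-zero = ℕΣ.sum-replicate-zero

∑-mono : ∀ {n} {f g : Fin n → ℕ} → (∀ i → f i ≤ g i) → ∑ f ≤ ∑ g
∑-mono {zero} f≤g = z≤n
∑-mono {suc n} f≤g = ℕ.+-mono-≤ (f≤g zero) (∑-mono (f≤g ∘ suc))

∑-const : ∀ n c → ∑ {n} (λ _ → c) ≡ n * c
∑-const zero c = refl
∑-const (suc n) c = cong (_+_ c) (∑-const n c)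

FourAry : ℕ → Set
FourAry n = Fin n → Fin n → Fin n → Fin n → ℕ

∑⁴ : ∀ {n} → FourAry n → ℕ
∑⁴ {n} f = ∑ {n} λ a → ∑ {n} λ b → ∑ {n} λ c → ∑ {n} λ d → f a b c d

∑⁴-cong : ∀ {n} {f g : FourAry n} → (∀ a b c d → f a b c d ≡ g a b c d) → ∑⁴ f ≡ ∑⁴ g
∑⁴-cong {n} eq = ∑-cong {n} λ a → ∑-cong {n} λ b → ∑-cong {n} λ c → ∑-cong {n} λ d → eq a b c d

∑⁴-mono : ∀ {n} {f g : FourAry n} → (∀ a b c d → f a b c d ≤ g a b c d) → ∑⁴ f ≤ ∑⁴ g
∑⁴-mono {n} le = ∑-mono {n} λ a → ∑-mono {n} λ b → ∑-mono {n} λ c → ∑-mono {n} λ d → le a b c d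

∑⁴-+ : ∀ {n} (f g : FourAry n) → ∑⁴ (λ a b c d → f a b c d + g a b c d) ≡ ∑⁴ f + ∑⁴ g
∑⁴-+ {n} f g =
  step (λ a → step (λ b → step (λ c → ℕΣ.∑-distrib-+ {n} (f a b c) (g a b c))))
  where
  step : {h f g : Fin n → ℕ} → (∀ i → h i ≡ f i + g i) → ∑ h ≡ ∑ f + ∑ g
  step {f = f} {g} eq = trans (∑-cong eq) (ℕΣ.∑-distrib-+ {n} f g)

∑ℤ-mono : ∀ {n} {f g : Fin n → ℤ} → (∀ i → f i ℤ.≤ g i) → ∑ℤ f ℤ.≤ ∑ℤ g
∑ℤ-mono {zero} f≤g = ℤ.≤-refl
∑ℤ-mono {suc n} f≤g = ℤ.+-mono-≤ (f≤g zero) (∑ℤ-mono (f≤g ∘ suc))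

∑ℤ-const : ∀ n (k : ℤ) → ∑ℤ {n} (λ _ → k) ≡ + n ℤ.* k
∑ℤ-const zero k = sym (ℤ.*-zeroˡ k)
∑ℤ-const (suc n) k = trans (cong (ℤ._+_ k) (∑ℤ-const n k)) (sym (ℤ.suc-* (+ n) k))

∑ℤ-pos : ∀ {n} (f : Fin n → ℕ) → ∑ℤ (λ i → + f i) ≡ + ∑ f
∑ℤ-pos {zero} f = refl
∑ℤ-pos {suc n} f = trans (cong (ℤ._+_ (+ f zero)) (∑ℤ-pos (f ∘ suc))) (sym (ℤ.pos-+ (f zero) _))

∑ℤ-nonneg : ∀ {n} {f : Fin n → ℤ} → (∀ i → + 0 ℤ.≤ f i) → + 0 ℤ.≤ ∑ℤ f
∑ℤ-nonneg {zero} p = ℤ.≤-refl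
∑ℤ-nonneg {suc n} p = ℤ.+-mono-≤ (p zero) (∑ℤ-nonneg (p ∘ suc))

square-nonneg : ∀ m i → + 0 ℤ.≤ + m ℤ.* (i ℤ.* i)
square-nonneg m (+ i) rewrite sym (ℤ.pos-* i i) | sym (ℤ.pos-* m (i * i)) = +≤+ z≤n
square-nonneg m -[1+ i ] rewrite sym (ℤ.pos-* m (suc i * suc i)) = +≤+ z≤n

-- Sums over five-tuples: squares and symmetrisation

module FiveFoldSums (n : ℕ) where

  ∑ₙ : (Fin n → ℤ) → ℤ
  ∑ₙ = ∑ℤ {n}

  cong∑ : {f g : Fin n → ℤ} → (∀ i → f i ≡ g i) → ∑ₙ f ≡ ∑ₙ g
  cong∑ {f} {g} = ℤΣ.sum-cong-≗ {n} {f} {g}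

  swap∑ : (f : Fin n → Fin n → ℤ) → ∑ₙ (λ i → ∑ₙ (λ j → f i j)) ≡ ∑ₙ (λ j → ∑ₙ (λ i → f i j))
  swap∑ = ℤΣ.∑-comm {n} {n}

  distribˡ∑ : ∀ k (f : Fin n → ℤ) → k ℤ.* ∑ₙ f ≡ ∑ₙ (λ i → k ℤ.* f i)
  distribˡ∑ = ℤΣ.*-distribˡ-sum {n}

  distribʳ∑ : ∀ k (f : Fin n → ℤ) → ∑ₙ f ℤ.* k ≡ ∑ₙ (λ i → f i ℤ.* k)
  distribʳ∑ = ℤΣ.*-distribʳ-sum {n}

  add∑ : (f g : Fin n → ℤ) → ∑ₙ (λ i → f i ℤ.+ g i) ≡ ∑ₙ f ℤ.+ ∑ₙ g
  add∑ = ℤΣ.∑-distrib-+ {n}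

  ∑∑-product : ∀ k (u w : Fin n → ℤ) →
               ∑ₙ (λ i → ∑ₙ (λ j → k ℤ.* (u i ℤ.* w j))) ≡ k ℤ.* (∑ₙ u ℤ.* ∑ₙ w)
  ∑∑-product k u w = begin
    ∑ₙ (λ i → ∑ₙ (λ j → k ℤ.* (u i ℤ.* w j)))  ≡⟨ cong∑ (λ i → distribˡ∑ k _) ⟨
    ∑ₙ (λ i → k ℤ.* ∑ₙ (λ j → u i ℤ.* w j))    ≡⟨ cong∑ (λ i → cong (k ℤ.*_) (distribˡ∑ (u i) w)) ⟨
    ∑ₙ (λ i → k ℤ.* (u i ℤ.* ∑ₙ w))            ≡⟨ distribˡ∑ k _ ⟨
    k ℤ.* ∑ₙ (λ i → u i ℤ.* ∑ₙ w)              ≡⟨ cong (k ℤ.*_) (distribʳ∑ (∑ₙ w) u) ⟨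
    k ℤ.* (∑ₙ u ℤ.* ∑ₙ w)                      ∎
    where open ≡-Reasoning

  gram-nonneg : ∀ m (u : Fin n → ℤ) →
                + 0 ℤ.≤ ∑ₙ (λ i → ∑ₙ (λ j → + m ℤ.* (u i ℤ.* u j)))
  gram-nonneg m u = subst (+ 0 ℤ.≤_) (sym (∑∑-product (+ m) u u)) (square-nonneg m (∑ₙ u))

  -- Exchanging the sums over `b` and `c` exhibits the square of the total of the row sums
  -- `∑ₙ (u a)`.
  gram₂-nonneg : ∀ m (u : Fin n → Fin n → ℤ) →
    + 0 ℤ.≤ ∑ₙ (λ a → ∑ₙ (λ b → ∑ₙ (λ c → ∑ₙ (λ d → + m ℤ.* (u a b ℤ.* u c d)))))
  gram₂-nonneg m u = subst (+ 0 ℤ.≤_) (sym eq) (gram-nonneg m (λ a → ∑ₙ (u a)))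
    where
    open ≡-Reasoning
    eq = begin
      ∑ₙ (λ a → ∑ₙ (λ b → ∑ₙ (λ c → ∑ₙ (λ d → + m ℤ.* (u a b ℤ.* u c d)))))
        ≡⟨ cong∑ (λ a → swap∑ (λ b c → ∑ₙ (λ d → + m ℤ.* (u a b ℤ.* u c d)))) ⟩
      ∑ₙ (λ a → ∑ₙ (λ c → ∑ₙ (λ b → ∑ₙ (λ d → + m ℤ.* (u a b ℤ.* u c d)))))
        ≡⟨ cong∑ (λ a → cong∑ (λ c → ∑∑-product (+ m) (u a) (u c))) ⟩
      ∑ₙ (λ a → ∑ₙ (λ c → + m ℤ.* (∑ₙ (u a) ℤ.* ∑ₙ (u c)))) ∎

  -- Once the roots are fixed the type `s` is constant, and each branch of `flagPair` is a
  -- nonnegative combination of squares of sums over `c`.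
  flagPair-nonneg : ∀ s (x y z : Fin n → Bool) →
    + 0 ℤ.≤ ∑ₙ (λ c → ∑ₙ (λ d → flagPair s (x c) (y c) (z c) (x d) (y d) (z d)))
  flagPair-nonneg true x y z =
    subst (+ 0 ℤ.≤_) (sym (trans (cong∑ (λ c → add∑ _ _)) (add∑ _ _)))
      (ℤ.+-mono-≤ (gram-nonneg 16 (λ c → agreement (x c) (y c) (z c)))
                  (gram-nonneg 192 (λ c → difference (x c) (y c))))
  flagPair-nonneg false x y z = gram-nonneg 288 (λ c → if z c then + 0 else difference (x c) (y c))

  ∑⁵ : FiveAry (Fin n) ℤ → ℤ
  ∑⁵ F = ∑ₙ λ a → ∑ₙ λ b → ∑ₙ λ c → ∑ₙ λ d → ∑ₙ λ e → F a b c d e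

  ∑⁵-+ : ∀ (F H : FiveAry (Fin n) ℤ) →
         ∑⁵ (λ a b c d e → F a b c d e ℤ.+ H a b c d e) ≡ ∑⁵ F ℤ.+ ∑⁵ H
  ∑⁵-+ F H = step (λ a → step (λ b → step (λ c → step (λ d → step (λ e → refl)))))
    where
    step : {f g h : Fin n → ℤ} → (∀ i → f i ≡ g i ℤ.+ h i) → ∑ₙ f ≡ ∑ₙ g ℤ.+ ∑ₙ h
    step {g = g} {h} eq = trans (cong∑ eq) (add∑ g h)

  private
    Op = FiveAry (Fin n) ℤ → FiveAry (Fin n) ℤ

  τ₁₂ τ₂₃ τ₃₄ τ₄₅ : Op
  τ₁₂ F a b c d e = F b a c d e
  τ₂₃ F a b c d e = F a c b d e
  τ₃₄ F a b c d e = F a b d c e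
  τ₄₅ F a b c d e = F a b c e d

  Preserves∑ : Op → Set
  Preserves∑ τ = ∀ F → ∑⁵ (τ F) ≡ ∑⁵ F

  ∑-τ₁₂ : Preserves∑ τ₁₂
  ∑-τ₁₂ F = swap∑ _

  ∑-τ₂₃ : Preserves∑ τ₂₃
  ∑-τ₂₃ F = cong∑ λ a → swap∑ _

  ∑-τ₃₄ : Preserves∑ τ₃₄
  ∑-τ₃₄ F = cong∑ λ a → cong∑ λ b → swap∑ _

  ∑-τ₄₅ : Preserves∑ τ₄₅
  ∑-τ₄₅ F = cong∑ λ a → cong∑ λ b → cong∑ λ c → swap∑ _

  -- Adjacent transpositions exchange neighbouring sums; every other transposition is a conjugate,
  -- as in (1 3) = (1 2)(2 3)(1 2).
  conjugate : ∀ {σ τ : Op} → Preserves∑ σ → Preserves∑ τ → Preserves∑ (σ ∘ τ ∘ σ)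
  conjugate p q F = trans (p _) (trans (q _) (p F))

  ∑-τ₁₃ = conjugate ∑-τ₁₂ ∑-τ₂₃
  ∑-τ₂₄ = conjugate ∑-τ₂₃ ∑-τ₃₄
  ∑-τ₁₄ = conjugate ∑-τ₁₂ ∑-τ₂₄
  ∑-τ₃₅ = conjugate ∑-τ₃₄ ∑-τ₄₅
  ∑-τ₂₅ = conjugate ∑-τ₂₃ ∑-τ₃₅
  ∑-τ₁₅ = conjugate ∑-τ₁₂ ∑-τ₂₅

  ∑-sym₂ : ∀ F → ∑⁵ (sym₂ F) ≡ + 2 ℤ.* ∑⁵ F
  ∑-sym₂ F = begin
    ∑⁵ (sym₂ F)        ≡⟨ ∑⁵-+ F _ ⟩
    ∑⁵ F ℤ.+ ∑⁵ (τ₁₂ F) ≡⟨ cong (ℤ._+_ (∑⁵ F)) (∑-τ₁₂ F) ⟩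
    ∑⁵ F ℤ.+ ∑⁵ F       ≡⟨ collect (∑⁵ F) ⟩
    + 2 ℤ.* ∑⁵ F       ∎
    where
    open ≡-Reasoning
    collect : ∀ x → x ℤ.+ x ≡ + 2 ℤ.* x
    collect = ℤSolver.solve-∀

  ∑-sym₃ : ∀ F → ∑⁵ (sym₃ F) ≡ + 3 ℤ.* ∑⁵ F
  ∑-sym₃ F = trans (trans (∑⁵-+ F _) (cong (ℤ._+_ (∑⁵ F)) (trans (∑⁵-+ (τ₂₃ F) _)
    (cong₂ ℤ._+_ (∑-τ₂₃ F) (∑-τ₁₃ F))))) (collect (∑⁵ F))
    where
    collect : ∀ x → x ℤ.+ (x ℤ.+ x) ≡ + 3 ℤ.* x
    collect = ℤSolver.solve-∀

  ∑-sym₄ : ∀ F → ∑⁵ (sym₄ F) ≡ + 4 ℤ.* ∑⁵ F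
  ∑-sym₄ F = trans (trans (∑⁵-+ F _) (cong (ℤ._+_ (∑⁵ F)) (trans (∑⁵-+ (τ₃₄ F) _)
    (cong₂ ℤ._+_ (∑-τ₃₄ F) (trans (∑⁵-+ (λ a b c d e → F a d c b e) _)
    (cong₂ ℤ._+_ (∑-τ₂₄ F) (∑-τ₁₄ F))))))) (collect (∑⁵ F))
    where
    collect : ∀ x → x ℤ.+ (x ℤ.+ (x ℤ.+ x)) ≡ + 4 ℤ.* x
    collect = ℤSolver.solve-∀

  ∑-sym₅ : ∀ F → ∑⁵ (sym₅ F) ≡ + 5 ℤ.* ∑⁵ F
  ∑-sym₅ F = trans (trans (∑⁵-+ F _) (cong (ℤ._+_ (∑⁵ F)) (trans (∑⁵-+ (τ₄₅ F) _)
    (cong₂ ℤ._+_ (∑-τ₄₅ F) (trans (∑⁵-+ (λ a b c d e → F a b e d c) _)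
    (cong₂ ℤ._+_ (∑-τ₃₅ F) (trans (∑⁵-+ (λ a b c d e → F a e c d b) _)
    (cong₂ ℤ._+_ (∑-τ₂₅ F) (∑-τ₁₅ F))))))))) (collect (∑⁵ F))
    where
    collect : ∀ x → x ℤ.+ (x ℤ.+ (x ℤ.+ (x ℤ.+ x))) ≡ + 5 ℤ.* x
    collect = ℤSolver.solve-∀

  ∑-symm : ∀ F → ∑⁵ (symℤ F) ≡ + 120 ℤ.* ∑⁵ F
  ∑-symm F = begin
    ∑⁵ (symℤ F)
      ≡⟨ ∑-sym₅ _ ⟩
    + 5 ℤ.* ∑⁵ (sym₄ (sym₃ (sym₂ F)))
      ≡⟨ cong (+ 5 ℤ.*_) (trans (∑-sym₄ _) (cong (+ 4 ℤ.*_)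
           (trans (∑-sym₃ _) (cong (+ 3 ℤ.*_) (∑-sym₂ F))))) ⟩
    + 5 ℤ.* (+ 4 ℤ.* (+ 3 ℤ.* (+ 2 ℤ.* ∑⁵ F)))
      ≡⟨ collect (∑⁵ F) ⟩
    + 120 ℤ.* ∑⁵ F ∎
    where
    open ≡-Reasoning
    collect : ∀ x → + 5 ℤ.* (+ 4 ℤ.* (+ 3 ℤ.* (+ 2 ℤ.* x))) ≡ + 120 ℤ.* x
    collect = ℤSolver.solve-∀

  module _ (E : Triples (Fin n)) (G : IsGraph E)
           (noC5 : ∀ a b c d e → c5 E a b c d e ≡ false)
           (noF32 : ∀ a b c d e → f32 E a b c d e ≡ false) where

    -- The entries may coincide: `lookup` on the tuple is just a map from `Fin 5`, along which the
    -- graph is pulled back.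
    symm-certificate-≤ : ∀ a b c d e → symℤ (certificate E) a b c d e ℤ.≤ + 9720
    symm-certificate-≤ a b c d e = subst (ℤ._≤ + 9720)
      (sym (symm-natural ℤ._+_ v (certificate E) v1 v2 v3 v4 v5))
      (certified-graph (λ i j k → E (v i) (v j) (v k)) (pullback v G)
        (λ i j k l m → noC5 (v i) (v j) (v k) (v l) (v m))
        (λ i j k l m → noF32 (v i) (v j) (v k) (v l) (v m)))
      where
      v : Fin 5 → Fin n
      v = lookup (a ∷ b ∷ c ∷ d ∷ e ∷ [])

    -- `target` is constant in its last argument; summing that out leaves the factor `n`.
    ∑⁵-target : ∑⁵ (target E) ≡ + (n * (144 * ∑⁴ (twoEdges E)))
    ∑⁵-target = begin
      ∑⁵ (target E)
        ≡⟨ pull (λ a → pull (λ b → pull (λ c → pull (λ d → trans (∑ℤ-const n _)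
             (cong (+ n ℤ.*_) (sym (ℤ.pos-* 144 (t a b c d)))))))) ⟩
      + n ℤ.* ∑ₙ (λ a → ∑ₙ λ b → ∑ₙ λ c → ∑ₙ λ d → + (144 * t a b c d))
        ≡⟨ cong (+ n ℤ.*_) (nat (λ a → nat (λ b → nat (λ c → nat (λ d → refl))))) ⟩
      + n ℤ.* + (144 * ∑⁴ (twoEdges E))
        ≡⟨ ℤ.pos-* n (144 * ∑⁴ (twoEdges E)) ⟨
      + (n * (144 * ∑⁴ (twoEdges E))) ∎
      where
      open ≡-Reasoning
      t : FourAry n
      t = twoEdges E
      pull : {f g : Fin n → ℤ} → (∀ i → f i ≡ + n ℤ.* g i) → ∑ₙ f ≡ + n ℤ.* ∑ₙ g
      pull {g = g} eq = trans (cong∑ eq) (sym (distribˡ∑ (+ n) g))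
      nat : {f : Fin n → ℤ} {g : Fin n → ℕ} → (∀ i → f i ≡ + (144 * g i)) → ∑ₙ f ≡ + (144 * ∑ g)
      nat {g = g} eq = trans (cong∑ eq)
        (trans (∑ℤ-pos (λ i → 144 * g i)) (cong (λ m → + m) (sym (ℕΣ.*-distribˡ-sum {n} 144 g))))

    ∑⁵-target≤certificate : ∑⁵ (target E) ℤ.≤ ∑⁵ (certificate E)
    ∑⁵-target≤certificate = subst (∑⁵ (target E) ℤ.≤_)
      (sym (trans (∑⁵-+ (target E) _) (cong (ℤ._+_ (∑⁵ (target E))) (∑⁵-+ (vertexFlags E) (tripleFlags E)))))
      (ℤ.≤-trans (ℤ.≤-reflexive (sym (ℤ.+-identityʳ _)))
        (ℤ.+-monoʳ-≤ (∑⁵ (target E)) (ℤ.+-mono-≤ vertex triples)))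
      where
      vertex : + 0 ℤ.≤ ∑⁵ (vertexFlags E)
      vertex = ∑ℤ-nonneg λ r → gram₂-nonneg 9 (λ a b → edgeDefect (E r a b))
      triples : + 0 ℤ.≤ ∑⁵ (tripleFlags E)
      triples = ∑ℤ-nonneg λ r → ∑ℤ-nonneg λ a → ∑ℤ-nonneg λ b →
        flagPair-nonneg (E r a b) (E r a) (E r b) (E a b)

    ∑⁵-const : ∀ m → ∑⁵ (λ _ _ _ _ _ → + m) ≡ + (n * (n * (n * (n * (n * m)))))
    ∑⁵-const m = step (step (step (step (step refl))))
      where
      step : ∀ {x m} → x ≡ + m → ∑ₙ (λ _ → x) ≡ + (n * m)
      step {m = m} refl = trans (∑ℤ-const n (+ m)) (sym (ℤ.pos-* n m))

    ∑-twoEdges-scaled : 120 * (n * (144 * ∑⁴ (twoEdges E))) ≤ n * (n * (n * (n * (n * 9720))))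
    ∑-twoEdges-scaled = ℤ.drop‿+≤+ (begin
      + (120 * (n * (144 * ∑⁴ (twoEdges E))))
        ≡⟨ ℤ.pos-* 120 (n * (144 * ∑⁴ (twoEdges E))) ⟩
      + 120 ℤ.* + (n * (144 * ∑⁴ (twoEdges E)))
        ≡⟨ cong (+ 120 ℤ.*_) ∑⁵-target ⟨
      + 120 ℤ.* ∑⁵ (target E)
        ≤⟨ ℤ.*-monoˡ-≤-nonNeg (+ 120) ∑⁵-target≤certificate ⟩
      + 120 ℤ.* ∑⁵ (certificate E)
        ≡⟨ ∑-symm (certificate E) ⟨
      ∑⁵ (symℤ (certificate E))
        ≤⟨ ∑ℤ-mono (λ a → ∑ℤ-mono λ b → ∑ℤ-mono λ c → ∑ℤ-mono λ d → ∑ℤ-mono λ e →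
             symm-certificate-≤ a b c d e) ⟩
      ∑⁵ (λ _ _ _ _ _ → + 9720)
        ≡⟨ ∑⁵-const 9720 ⟩
      + (n * (n * (n * (n * (n * 9720))))) ∎)
      where open ℤ.≤-Reasoning

open FiveFoldSums

∑-twoEdges-≤ : ∀ {n} (E : Triples (Fin n)) → IsGraph E →
         (∀ a b c d e → c5 E a b c d e ≡ false) → (∀ a b c d e → f32 E a b c d e ≡ false) →
         16 * ∑⁴ (twoEdges E) ≤ 9 * (n * n * n * n)
∑-twoEdges-≤ {zero} E G _ _ = z≤n
-- 1080 is the greatest common divisor of 120 · 144 and 9720, with quotients 16 and 9. The other
-- factor is the vertex that `target` does not see, hence the separate case of no vertices.
∑-twoEdges-≤ {suc m} E G p q = ℕ.*-cancelˡ-≤ (1080 * suc m)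
  (subst₂ _≤_ (lhs (suc m) (∑⁴ (twoEdges E))) (rhs (suc m)) (∑-twoEdges-scaled _ E G p q))
  where
  lhs : ∀ n t → 120 * (n * (144 * t)) ≡ 1080 * n * (16 * t)
  lhs = solve-∀
  rhs : ∀ n → n * (n * (n * (n * (n * 9720)))) ≡ 1080 * n * (9 * (n * n * n * n))
  rhs = solve-∀

-- Counting subsets by ordered tuples

count : ∀ {A : Set} → (A → Bool) → List A → ℕ
count p xs = length (filterᵇ p xs)

module _ {A : Set} where

  count-cons : ∀ (p : A → Bool) x xs → count p (x ∷ xs) ≡ bit (p x) + count p xs
  count-cons p x xs with p x
  ... | true = refl
  ... | false = refl

  count-cong : ∀ {p q : A → Bool} → (∀ x → p x ≡ q x) → ∀ xs → count p xs ≡ count q xs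
  count-cong eq [] = refl
  count-cong {p} {q} eq (x ∷ xs) = begin
    count p (x ∷ xs)          ≡⟨ count-cons p x xs ⟩
    bit (p x) + count p xs    ≡⟨ cong₂ _+_ (cong bit (eq x)) (count-cong eq xs) ⟩
    bit (q x) + count q xs    ≡⟨ count-cons q x xs ⟨
    count q (x ∷ xs)          ∎
    where open ≡-Reasoning

  count-none : ∀ {p : A → Bool} → (∀ x → p x ≡ false) → ∀ xs → count p xs ≡ 0
  count-none eq [] = refl
  count-none {p} eq (x ∷ xs) =
    trans (count-cons p x xs) (cong₂ _+_ (cong bit (eq x)) (count-none eq xs))

  count-++ : ∀ (p : A → Bool) xs ys → count p (xs ++ ys) ≡ count p xs + count p ys
  count-++ p [] ys = refl
  count-++ p (x ∷ xs) ys = begin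
    count p (x ∷ xs ++ ys)                   ≡⟨ count-cons p x (xs ++ ys) ⟩
    bit (p x) + count p (xs ++ ys)           ≡⟨ cong (_+_ (bit (p x))) (count-++ p xs ys) ⟩
    bit (p x) + (count p xs + count p ys)    ≡⟨ ℕ.+-assoc (bit (p x)) _ _ ⟨
    bit (p x) + count p xs + count p ys      ≡⟨ cong (_+ count p ys) (count-cons p x xs) ⟨
    count p (x ∷ xs) + count p ys            ∎
    where open ≡-Reasoning

count-map : ∀ {A B : Set} (p : B → Bool) (f : A → B) xs → count p (map f xs) ≡ count (p ∘ f) xs
count-map p f [] = refl
count-map p f (x ∷ xs) =
  trans (count-cons p (f x) (map f xs))
    (trans (cong (_+_ (bit (p (f x)))) (count-map p f xs)) (sym (count-cons (p ∘ f) x xs)))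


-- The recursion is Pascal's rule. One operation serves both counts, edges inside a set and 4-sets
-- of vertices, and natural-number weights allow conditions such as `outside-only` inside the sum.
subsetSum : ∀ {n} → ℕ → Subset n → (Subset n → ℕ) → ℕ
subsetSum zero [] f = f []
subsetSum (suc k) [] f = 0
subsetSum k (false ∷ S) f = subsetSum k S (f ∘ (false ∷_))
subsetSum zero (true ∷ S) f = subsetSum zero S (f ∘ (false ∷_))
subsetSum (suc k) (true ∷ S) f =
  subsetSum (suc k) S (f ∘ (false ∷_)) + subsetSum k S (f ∘ (true ∷_))

subsetSum-cong : ∀ {n} k (S : Subset n) {f g} → (∀ T → f T ≡ g T) →
                 subsetSum k S f ≡ subsetSum k S g
subsetSum-cong zero [] eq = eq []
subsetSum-cong (suc k) [] eq = refl
subsetSum-cong zero (false ∷ S) eq = subsetSum-cong zero S (λ T → eq (false ∷ T))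
subsetSum-cong (suc k) (false ∷ S) eq = subsetSum-cong (suc k) S (λ T → eq (false ∷ T))
subsetSum-cong zero (true ∷ S) eq = subsetSum-cong zero S (λ T → eq (false ∷ T))
subsetSum-cong (suc k) (true ∷ S) eq =
  cong₂ _+_ (subsetSum-cong (suc k) S (λ T → eq (false ∷ T)))
            (subsetSum-cong k S (λ T → eq (true ∷ T)))

subsetSum-zero : ∀ {n} (S : Subset n) f → subsetSum zero S f ≡ f ⊥
subsetSum-zero [] f = refl
subsetSum-zero (false ∷ S) f = subsetSum-zero S _
subsetSum-zero (true ∷ S) f = subsetSum-zero S _

subsetSum-⊥ : ∀ {n} k (f : Subset n → ℕ) → subsetSum (suc k) ⊥ f ≡ 0
subsetSum-⊥ {zero} k f = refl
subsetSum-⊥ {suc n} k f = subsetSum-⊥ {n} k _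

subsetSum-∑ : ∀ {n m} k (S : Subset n) (f : Fin m → Subset n → ℕ) →
              subsetSum k S (λ T → ∑ (λ i → f i T)) ≡ ∑ (λ i → subsetSum k S (f i))
subsetSum-∑ zero [] f = refl
subsetSum-∑ {m = m} (suc k) [] f = sym (∑-zero m)
subsetSum-∑ zero (false ∷ S) f = subsetSum-∑ zero S (λ i → f i ∘ (false ∷_))
subsetSum-∑ (suc k) (false ∷ S) f = subsetSum-∑ (suc k) S (λ i → f i ∘ (false ∷_))
subsetSum-∑ zero (true ∷ S) f = subsetSum-∑ zero S (λ i → f i ∘ (false ∷_))
subsetSum-∑ (suc k) (true ∷ S) f =
  trans (cong₂ _+_ (subsetSum-∑ (suc k) S (λ i → f i ∘ (false ∷_)))
                   (subsetSum-∑ k S (λ i → f i ∘ (true ∷_))))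
        (sym (ℕΣ.∑-distrib-+ (λ i → subsetSum (suc k) S (f i ∘ (false ∷_))) _))

count-subsets : ∀ {n} k (S : Subset n) (q : Subset n → Bool) →
  count (λ T → (∣ T ∣ ≡ᵇ k) ∧ ((T ⊆ᵇ S) ∧ q T)) (allSubsets n) ≡ subsetSum k S (bit ∘ q)
count-subsets zero [] q =
  trans (count-cons (λ T → (∣ T ∣ ≡ᵇ 0) ∧ ((T ⊆ᵇ []) ∧ q T)) [] []) (ℕ.+-identityʳ (bit (q [])))
count-subsets (suc k) [] q = refl
count-subsets {suc n} k (b ∷ S) q = begin
  count p (map (false ∷_) (allSubsets n) ++ map (true ∷_) (allSubsets n))
    ≡⟨ count-++ p (map (false ∷_) (allSubsets n)) _ ⟩
  count p (map (false ∷_) (allSubsets n)) + count p (map (true ∷_) (allSubsets n))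
    ≡⟨ cong₂ _+_ (count-map p (false ∷_) (allSubsets n)) (count-map p (true ∷_) (allSubsets n)) ⟩
  count (p ∘ (false ∷_)) (allSubsets n) + count (p ∘ (true ∷_)) (allSubsets n)
    ≡⟨ cong (_+ count (p ∘ (true ∷_)) (allSubsets n)) (count-subsets k S (q ∘ (false ∷_))) ⟩
  subsetSum k S (bit ∘ q ∘ (false ∷_)) + count (p ∘ (true ∷_)) (allSubsets n)
    ≡⟨ rest k b ⟩
  subsetSum k (b ∷ S) (bit ∘ q) ∎
  where
  open ≡-Reasoning
  p : Subset (suc n) → Bool
  p T = (∣ T ∣ ≡ᵇ k) ∧ ((T ⊆ᵇ (b ∷ S)) ∧ q T)
  with-first : ℕ → Bool → Subset n → Bool
  with-first k b T = (suc ∣ T ∣ ≡ᵇ k) ∧ ((b ∧ (T ⊆ᵇ S)) ∧ q (true ∷ T))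
  nothing-added : ∀ k {p′ : Subset n → Bool} → (∀ T → p′ T ≡ false) →
    subsetSum k S (bit ∘ q ∘ (false ∷_)) + count p′ (allSubsets n) ≡
    subsetSum k S (bit ∘ q ∘ (false ∷_))
  nothing-added k none = trans
    (cong (_+_ (subsetSum k S (bit ∘ q ∘ (false ∷_)))) (count-none none (allSubsets n)))
    (ℕ.+-identityʳ _)
  rest : ∀ k b → subsetSum k S (bit ∘ q ∘ (false ∷_)) + count (with-first k b) (allSubsets n)
         ≡ subsetSum k (b ∷ S) (bit ∘ q)
  rest zero false = nothing-added zero (λ _ → refl)
  rest (suc k) false = nothing-added (suc k) (λ T → ∧-zeroʳ (∣ T ∣ ≡ᵇ k))
  rest zero true = nothing-added zero (λ _ → refl)
  rest (suc k) true =
    cong (_+_ (subsetSum (suc k) S (bit ∘ q ∘ (false ∷_)))) (count-subsets k S (q ∘ (true ∷_)))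

⊆ᵇ-⊤ : ∀ {n} (T : Subset n) → (T ⊆ᵇ ⊤) ≡ true
⊆ᵇ-⊤ [] = refl
⊆ᵇ-⊤ (false ∷ T) = ⊆ᵇ-⊤ T
⊆ᵇ-⊤ (true ∷ T) = ⊆ᵇ-⊤ T

e42-subsetSum : ∀ {n} (G : Graph3 n) →
  e42 G ≡ subsetSum 4 ⊤ (λ S → bit (subsetSum 3 S (bit ∘ G) ≡ᵇ 2))
e42-subsetSum {n} G = begin
  e42 G
    -- The vacuous test against `⊤` gives the filter the shape required by `count-subsets`.
    ≡⟨ count-cong (λ S → cong (λ b → (∣ S ∣ ≡ᵇ 4) ∧ (b ∧ (edgesIn G S ≡ᵇ 2))) (sym (⊆ᵇ-⊤ S))) (allSubsets n) ⟩
  count (λ S → (∣ S ∣ ≡ᵇ 4) ∧ ((S ⊆ᵇ ⊤) ∧ (edgesIn G S ≡ᵇ 2))) (allSubsets n)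
    ≡⟨ count-subsets 4 ⊤ (λ S → edgesIn G S ≡ᵇ 2) ⟩
  subsetSum 4 ⊤ (λ S → bit (edgesIn G S ≡ᵇ 2))
    ≡⟨ subsetSum-cong 4 ⊤ (λ S → cong (λ m → bit (m ≡ᵇ 2)) (count-subsets 3 S G)) ⟩
  subsetSum 4 ⊤ (λ S → bit (subsetSum 3 S (bit ∘ G) ≡ᵇ 2)) ∎
  where open ≡-Reasoning

outside-only : ∀ {n} → Fin n → Subset n → ℕ → ℕ
outside-only a S x = if lookup S a then 0 else x

-- Both sides count sets of size `suc k` with a marked element `a`: on the right, `S` is what
-- remains after removing `a`.
double-count : ∀ n k (f : Subset n → ℕ) →
  suc k * subsetSum (suc k) ⊤ f ≡
  ∑ {n} (λ a → subsetSum k ⊤ (λ S → outside-only a S (f (S [ a ]≔ true))))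
double-count zero k f = ℕ.*-zeroʳ (suc k)
double-count (suc n) zero f = begin
  1 * (subsetSum 1 ⊤ (f ∘ (false ∷_)) + subsetSum 0 ⊤ (f ∘ (true ∷_)))
    ≡⟨ rearrange (subsetSum 1 (⊤ {n}) (f ∘ (false ∷_))) (subsetSum 0 (⊤ {n}) (f ∘ (true ∷_))) ⟩
  subsetSum 0 ⊤ (f ∘ (true ∷_)) + 1 * subsetSum 1 ⊤ (f ∘ (false ∷_))
    ≡⟨ cong (_+_ (subsetSum 0 (⊤ {n}) (f ∘ (true ∷_)))) (double-count n 0 (f ∘ (false ∷_))) ⟩
  subsetSum 0 ⊤ (f ∘ (true ∷_)) +
    ∑ {n} (λ a → subsetSum 0 ⊤ (λ S → outside-only a S (f (false ∷ (S [ a ]≔ true))))) ∎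
  where
  open ≡-Reasoning
  rearrange : ∀ x y → 1 * (x + y) ≡ y + 1 * x
  rearrange = solve-∀
double-count (suc n) (suc k) f = begin
  suc (suc k) * (X + Y)
    ≡⟨ rearrange k X Y ⟩
  -- `X` collects the sets without the first vertex, `Y` those with it. Marking the first vertex
  -- gives `Y`, where the 0 comes from sets `S` that already contain it; marking another vertex
  -- gives the rest by induction.
  Y + 0 + (suc (suc k) * X + suc k * Y)
    ≡⟨ cong₂ _+_ (cong (_+_ Y) (sym (subsetSum-0 k (⊤ {n}))))
         (trans (cong₂ _+_ (double-count n (suc k) (f ∘ (false ∷_))) (double-count n k (f ∘ (true ∷_))))
           (sym (ℕΣ.∑-distrib-+ {n}
             (λ a → subsetSum (suc k) ⊤ (λ S → outside-only a S (f (false ∷ (S [ a ]≔ true))))) _))) ⟩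
  ∑ {suc n} (λ a → subsetSum (suc k) ⊤ (λ S → outside-only a S (f (S [ a ]≔ true)))) ∎
  where
  open ≡-Reasoning
  X = subsetSum (suc (suc k)) (⊤ {n}) (f ∘ (false ∷_))
  Y = subsetSum (suc k) (⊤ {n}) (f ∘ (true ∷_))
  rearrange : ∀ k x y → suc (suc k) * (x + y) ≡ y + 0 + (suc (suc k) * x + suc k * y)
  rearrange = solve-∀
  subsetSum-0 : ∀ {n} k (S : Subset n) → subsetSum k S (λ _ → 0) ≡ 0
  subsetSum-0 zero [] = refl
  subsetSum-0 (suc k) [] = refl
  subsetSum-0 zero (false ∷ S) = subsetSum-0 zero S
  subsetSum-0 (suc k) (false ∷ S) = subsetSum-0 (suc k) S
  subsetSum-0 zero (true ∷ S) = subsetSum-0 zero S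
  subsetSum-0 (suc k) (true ∷ S) = cong₂ _+_ (subsetSum-0 (suc k) S) (subsetSum-0 k S)

-- The last entry of the tuple is inserted first.
tupleSum : ∀ {n} → ℕ → (Subset n → ℕ) → ℕ
tupleSum zero f = f ⊥
tupleSum {n} (suc k) f = ∑ {n} λ a → tupleSum k (λ S → outside-only a S (f (S [ a ]≔ true)))

tupleSum-subsetSum : ∀ {n} k (f : Subset n → ℕ) → k ! * subsetSum k ⊤ f ≡ tupleSum k f
tupleSum-subsetSum {n} zero f = trans (ℕ.*-identityˡ _) (subsetSum-zero (⊤ {n}) f)
tupleSum-subsetSum {n} (suc k) f = begin
  suc k * k ! * subsetSum (suc k) ⊤ f
    ≡⟨ rearrange (suc k) (k !) (subsetSum (suc k) (⊤ {n}) f) ⟩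
  k ! * (suc k * subsetSum (suc k) ⊤ f)
    ≡⟨ cong (k ! *_) (double-count n k f) ⟩
  k ! * ∑ {n} (λ a → subsetSum k ⊤ (λ S → outside-only a S (f (S [ a ]≔ true))))
    ≡⟨ ℕΣ.*-distribˡ-sum {n} (k !) _ ⟩
  ∑ {n} (λ a → k ! * subsetSum k ⊤ (λ S → outside-only a S (f (S [ a ]≔ true))))
    ≡⟨ ∑-cong {n} (λ a → tupleSum-subsetSum k _) ⟩
  tupleSum (suc k) f ∎
  where
  open ≡-Reasoning
  rearrange : ∀ x y z → x * y * z ≡ y * (x * z)
  rearrange = solve-∀

-- The subsets of the enlarged set are split by whether they contain `a`; those that do are smaller
-- subsets of `S` with `a` added.
subsetSum-insert : ∀ {n} k (S : Subset n) a f → lookup S a ≡ false →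
  subsetSum (suc k) (S [ a ]≔ true) f ≡
  subsetSum (suc k) S f + subsetSum k S (λ T → f (T [ a ]≔ true))
subsetSum-insert zero (false ∷ S) zero f a∉S = refl
subsetSum-insert (suc k) (false ∷ S) zero f a∉S = refl
subsetSum-insert zero (false ∷ S) (suc a) f a∉S = subsetSum-insert zero S a _ a∉S
subsetSum-insert (suc k) (false ∷ S) (suc a) f a∉S = subsetSum-insert (suc k) S a _ a∉S
subsetSum-insert {suc n} zero (true ∷ S) (suc a) f a∉S = begin
  subsetSum 1 (S [ a ]≔ true) f₀ + subsetSum 0 (S [ a ]≔ true) f₁
    ≡⟨ cong₂ _+_ (subsetSum-insert zero S a f₀ a∉S)
         (trans (subsetSum-zero (S [ a ]≔ true) f₁) (sym (subsetSum-zero S f₁))) ⟩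
  subsetSum 1 S f₀ + subsetSum 0 S (λ T → f₀ (T [ a ]≔ true)) + subsetSum 0 S f₁
    ≡⟨ rearrange (subsetSum 1 S f₀) _ (subsetSum 0 S f₁) ⟩
  subsetSum 1 S f₀ + subsetSum 0 S f₁ + subsetSum 0 S (λ T → f₀ (T [ a ]≔ true)) ∎
  where
  open ≡-Reasoning
  f₀ f₁ : Subset n → ℕ
  f₀ = f ∘ (false ∷_)
  f₁ = f ∘ (true ∷_)
  rearrange : ∀ x y z → x + y + z ≡ x + z + y
  rearrange = solve-∀
subsetSum-insert {suc n} (suc k) (true ∷ S) (suc a) f a∉S = begin
  subsetSum (2 + k) (S [ a ]≔ true) f₀ + subsetSum (1 + k) (S [ a ]≔ true) f₁
    ≡⟨ cong₂ _+_ (subsetSum-insert (suc k) S a f₀ a∉S) (subsetSum-insert k S a f₁ a∉S) ⟩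
  subsetSum (2 + k) S f₀ + subsetSum (1 + k) S (λ T → f₀ (T [ a ]≔ true)) +
    (subsetSum (1 + k) S f₁ + subsetSum k S (λ T → f₁ (T [ a ]≔ true)))
    ≡⟨ rearrange (subsetSum (2 + k) S f₀) (subsetSum (1 + k) S (λ T → f₀ (T [ a ]≔ true)))
         (subsetSum (1 + k) S f₁) _ ⟩
  subsetSum (2 + k) S f₀ + subsetSum (1 + k) S f₁ +
    (subsetSum (1 + k) S (λ T → f₀ (T [ a ]≔ true)) + subsetSum k S (λ T → f₁ (T [ a ]≔ true))) ∎
  where
  open ≡-Reasoning
  f₀ f₁ : Subset n → ℕ
  f₀ = f ∘ (false ∷_)
  f₁ = f ∘ (true ∷_)
  rearrange : ∀ x y z w → x + y + (z + w) ≡ x + z + (y + w)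
  rearrange = solve-∀

insert-∪ : ∀ {n} (S : Subset n) a → S [ a ]≔ true ≡ ⁅ a ⁆ ∪ S
insert-∪ (b ∷ S) zero = cong (true ∷_) (sym (∪-identityˡ S))
insert-∪ (b ∷ S) (suc a) = cong (b ∷_) (insert-∪ S a)

insert-triple : ∀ {n} (a b c : Fin n) → ((⊥ [ c ]≔ true) [ b ]≔ true) [ a ]≔ true ≡ triple a b c
insert-triple a b c
  rewrite insert-∪ ⊥ c | insert-∪ (⁅ c ⁆ ∪ ⊥) b | insert-∪ (⁅ b ⁆ ∪ (⁅ c ⁆ ∪ ⊥)) a
        | ∪-comm ⁅ c ⁆ ⊥ | ∪-identityˡ ⁅ c ⁆ = refl

module _ {n : ℕ} (a b c d : Fin n) where

  private
    S₁ S₂ S₃ S₄ : Subset n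
    S₁ = ⊥ [ d ]≔ true
    S₂ = S₁ [ c ]≔ true
    S₃ = S₂ [ b ]≔ true
    S₄ = S₃ [ a ]≔ true

  fourSet : Subset n
  fourSet = S₄

  -- Nested exactly as `tupleSum 4` unfolds, so that the two agree by computation.
  ifDistinct : ℕ → ℕ
  ifDistinct x = outside-only d ⊥ (outside-only c S₁ (outside-only b S₂ (outside-only a S₃ x)))

  ifDistinct-≤ : ∀ x → ifDistinct x ≤ x
  ifDistinct-≤ x with lookup ⊥ d | lookup S₁ c | lookup S₂ b | lookup S₃ a
  ... | true | _ | _ | _ = z≤n
  ... | false | true | _ | _ = z≤n
  ... | false | false | true | _ = z≤n
  ... | false | false | false | true = z≤n
  ... | false | false | false | false = ℕ.≤-refl

  -- Subtraction-free form of: a term bounded by 1 loses at most 1 on a tuple with a repetition and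
  -- nothing on the others.
  ifDistinct-complement : ∀ {x} → x ≤ 1 → x + ifDistinct 1 ≤ ifDistinct x + 1
  ifDistinct-complement {x} x≤1 with lookup ⊥ d | lookup S₁ c | lookup S₂ b | lookup S₃ a
  ... | true | _ | _ | _ = subst (_≤ 1) (sym (ℕ.+-identityʳ x)) x≤1
  ... | false | true | _ | _ = subst (_≤ 1) (sym (ℕ.+-identityʳ x)) x≤1
  ... | false | false | true | _ = subst (_≤ 1) (sym (ℕ.+-identityʳ x)) x≤1
  ... | false | false | false | true = subst (_≤ 1) (sym (ℕ.+-identityʳ x)) x≤1
  ... | false | false | false | false = ℕ.≤-refl

  ifDistinct-cong : ∀ {x y} →
    (lookup S₁ c ≡ false → lookup S₂ b ≡ false → lookup S₃ a ≡ false → x ≡ y) →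
    ifDistinct x ≡ ifDistinct y
  ifDistinct-cong eq with lookup ⊥ d | lookup S₁ c | lookup S₂ b | lookup S₃ a
  ... | true | _ | _ | _ = refl
  ... | false | true | _ | _ = refl
  ... | false | false | true | _ = refl
  ... | false | false | false | true = refl
  ... | false | false | false | false = eq refl refl refl

  private
    d∉⊥ : lookup ⊥ d ≡ false
    d∉⊥ = lookup-replicate d false

    one₁ : ∀ g → subsetSum 1 S₁ g ≡ g S₁
    one₁ g = trans (subsetSum-insert 0 ⊥ d g d∉⊥)
      (cong₂ _+_ (subsetSum-⊥ {n} 0 g) (subsetSum-zero (⊥ {n}) _))

    none₁ : ∀ k g → subsetSum (2 + k) S₁ g ≡ 0
    none₁ k g = trans (subsetSum-insert (suc k) ⊥ d g d∉⊥)
      (cong₂ _+_ (subsetSum-⊥ {n} (suc k) g) (subsetSum-⊥ {n} k _))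

  module _ (c∉ : lookup S₁ c ≡ false) where

    private
      one₂ : ∀ g → subsetSum 1 S₂ g ≡ g S₁ + g (⊥ [ c ]≔ true)
      one₂ g = trans (subsetSum-insert 0 S₁ c g c∉) (cong₂ _+_ (one₁ g) (subsetSum-zero S₁ _))

      two₂ : ∀ g → subsetSum 2 S₂ g ≡ g S₂
      two₂ g = trans (subsetSum-insert 1 S₁ c g c∉) (cong₂ _+_ (none₁ 0 g) (one₁ _))

      none₂ : ∀ g → subsetSum 3 S₂ g ≡ 0
      none₂ g = trans (subsetSum-insert 2 S₁ c g c∉) (cong₂ _+_ (none₁ 1 g) (none₁ 0 _))

    -- Peeling off `a`, then `b`, leaves subset sums over the pair `S₂`, which `one₂`, `two₂` and
    -- `none₂` evaluate.
    subsetSum-fourSet : lookup S₂ b ≡ false → lookup S₃ a ≡ false → ∀ g →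
      subsetSum 3 S₄ g ≡ g (triple a b c) + (g (triple a b d) + (g (triple a c d) + g (triple b c d)))
    subsetSum-fourSet b∉ a∉ g = begin
      subsetSum 3 S₄ g
        ≡⟨ subsetSum-insert 2 S₃ a g a∉ ⟩
      subsetSum 3 S₃ g + subsetSum 2 S₃ gₐ
        ≡⟨ cong₂ _+_ (subsetSum-insert 2 S₂ b g b∉) (subsetSum-insert 1 S₂ b gₐ b∉) ⟩
      subsetSum 3 S₂ g + subsetSum 2 S₂ (λ T → g (T [ b ]≔ true)) +
        (subsetSum 2 S₂ gₐ + subsetSum 1 S₂ (λ T → gₐ (T [ b ]≔ true)))
        ≡⟨ cong₂ _+_ (cong₂ _+_ (none₂ g) (two₂ _)) (cong₂ _+_ (two₂ gₐ) (one₂ _)) ⟩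
      g S₃ + (gₐ S₂ + (gₐ (S₁ [ b ]≔ true) + gₐ ((⊥ [ c ]≔ true) [ b ]≔ true)))
        ≡⟨ cong₂ _+_ (cong g (insert-triple b c d)) (cong₂ _+_ (cong g (insert-triple a c d))
             (cong₂ _+_ (cong g (insert-triple a b d)) (cong g (insert-triple a b c)))) ⟩
      g (triple b c d) + (g (triple a c d) + (g (triple a b d) + g (triple a b c)))
        ≡⟨ reverse (g (triple b c d)) (g (triple a c d)) (g (triple a b d)) (g (triple a b c)) ⟩
      g (triple a b c) + (g (triple a b d) + (g (triple a c d) + g (triple b c d))) ∎
      where
      open ≡-Reasoning
      gₐ : Subset n → ℕ
      gₐ T = g (T [ a ]≔ true)
      reverse : ∀ x y z w → x + (y + (z + w)) ≡ w + (z + (y + x))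
      reverse = solve-∀

onTriples : ∀ {n} → Graph3 n → Triples (Fin n)
onTriples G a b c = G (triple a b c)

e42-distinct : ∀ {n} (G : Graph3 n) →
  24 * e42 G ≡ ∑⁴ (λ a b c d → ifDistinct a b c d (twoEdges (onTriples G) a b c d))
e42-distinct {n} G = begin
  24 * e42 G
    ≡⟨ cong (24 *_) (e42-subsetSum G) ⟩
  24 * subsetSum 4 ⊤ isTwo
    ≡⟨ tupleSum-subsetSum 4 isTwo ⟩
  ∑⁴ (λ a b c d → ifDistinct a b c d (isTwo (fourSet a b c d)))
    ≡⟨ ∑⁴-cong (λ a b c d → ifDistinct-cong a b c d (λ c∉ b∉ a∉ →
         cong (λ m → bit (m ≡ᵇ 2)) (subsetSum-fourSet a b c d c∉ b∉ a∉ (bit ∘ G)))) ⟩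
  ∑⁴ (λ a b c d → ifDistinct a b c d (twoEdges (onTriples G) a b c d)) ∎
  where
  open ≡-Reasoning
  isTwo : Subset n → ℕ
  isTwo S = bit (subsetSum 3 S (bit ∘ G) ≡ᵇ 2)

e42-≤-∑-twoEdges : ∀ {n} (G : Graph3 n) → 24 * e42 G ≤ ∑⁴ (twoEdges (onTriples G))
e42-≤-∑-twoEdges G = subst (_≤ ∑⁴ (twoEdges (onTriples G))) (sym (e42-distinct G))
  (∑⁴-mono (λ a b c d → ifDistinct-≤ a b c d (twoEdges (onTriples G) a b c d)))

subsetSum-⊤-one : ∀ n k → subsetSum k (⊤ {n}) (λ _ → 1) ≡ n C k
subsetSum-⊤-one zero zero = refl
subsetSum-⊤-one zero (suc k) = refl
subsetSum-⊤-one (suc n) zero = subsetSum-zero (⊤ {suc n}) (λ _ → 1)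
subsetSum-⊤-one (suc n) (suc k) = begin
  subsetSum (suc k) (⊤ {n}) (λ _ → 1) + subsetSum k (⊤ {n}) (λ _ → 1)
    ≡⟨ cong₂ _+_ (subsetSum-⊤-one n (suc k)) (subsetSum-⊤-one n k) ⟩
  n C suc k + n C k
    ≡⟨ ℕ.+-comm (n C suc k) (n C k) ⟩
  n C k + n C suc k
    ≡⟨ nCk+nC[k+1]≡[n+1]C[k+1] n k ⟩
  suc n C suc k ∎
  where open ≡-Reasoning

two-≤1 : ∀ p q r s → two p q r s ≤ 1
two-≤1 p q r s with (bit p + (bit q + (bit r + bit s))) ≡ᵇ 2
... | true = ℕ.≤-refl
... | false = z≤n

-- Exactly `24 * (n C 4)` quadruples have distinct entries; each of the remaining ones contributes
-- at most 1.
∑-twoEdges-≤-e42 : ∀ {n} (G : Graph3 n) →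
  ∑⁴ (twoEdges (onTriples G)) + 24 * (n C 4) ≤ 24 * e42 G + n * n * n * n
∑-twoEdges-≤-e42 {n} G = begin
  ∑⁴ t + 24 * (n C 4)
    ≡⟨ cong (λ m → ∑⁴ t + 24 * m) (subsetSum-⊤-one n 4) ⟨
  ∑⁴ t + 24 * subsetSum 4 (⊤ {n}) (λ _ → 1)
    ≡⟨ cong (_+_ (∑⁴ t)) (tupleSum-subsetSum {n} 4 (λ _ → 1)) ⟩
  ∑⁴ t + ∑⁴ ones
    ≡⟨ ∑⁴-+ t ones ⟨
  ∑⁴ (λ a b c d → t a b c d + ones a b c d)
    ≤⟨ ∑⁴-mono (λ a b c d → ifDistinct-complement a b c d
         (two-≤1 (E a b c) (E a b d) (E a c d) (E b c d))) ⟩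
  ∑⁴ (λ a b c d → ifDistinct a b c d (t a b c d) + 1)
    ≡⟨ ∑⁴-+ (λ a b c d → ifDistinct a b c d (t a b c d)) (λ _ _ _ _ → 1) ⟩
  ∑⁴ (λ a b c d → ifDistinct a b c d (t a b c d)) + ∑⁴ {n} (λ _ _ _ _ → 1)
    ≡⟨ cong₂ _+_ (sym (e42-distinct G)) all-tuples ⟩
  24 * e42 G + n * n * n * n ∎
  where
  open ℕ.≤-Reasoning
  E = onTriples G
  t ones : FourAry n
  t = twoEdges (onTriples G)
  ones a b c d = ifDistinct a b c d 1
  nest : ∀ {x y} → x ≡ y → ∑ {n} (λ _ → x) ≡ n * y
  nest {x} refl = ∑-const n x
  all-tuples : ∑⁴ {n} (λ _ _ _ _ → 1) ≡ n * n * n * n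
  all-tuples = trans (nest (nest (nest (nest refl)))) (assoc n)
    where
    assoc : ∀ n → n * (n * (n * (n * 1))) ≡ n * n * n * n
    assoc = solve-∀

∪-slide : ∀ {n} (R S T : Subset n) → R ∪ (S ∪ T) ≡ S ∪ (R ∪ T)
∪-slide R S T = begin
  R ∪ (S ∪ T)    ≡⟨ ∪-assoc R S T ⟨
  (R ∪ S) ∪ T    ≡⟨ cong (_∪ T) (∪-comm R S) ⟩
  (S ∪ R) ∪ T    ≡⟨ ∪-assoc S R T ⟩
  S ∪ (R ∪ T)    ∎
  where open ≡-Reasoning

-- Upper bound

∣∪∣-≤ : ∀ {n} (S T : Subset n) → ∣ S ∪ T ∣ ≤ ∣ S ∣ + ∣ T ∣
∣∪∣-≤ [] [] = z≤n
∣∪∣-≤ (false ∷ S) (false ∷ T) = ∣∪∣-≤ S T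
∣∪∣-≤ (false ∷ S) (true ∷ T) =
  ℕ.≤-trans (s≤s (∣∪∣-≤ S T)) (ℕ.≤-reflexive (sym (ℕ.+-suc ∣ S ∣ ∣ T ∣)))
∣∪∣-≤ (true ∷ S) (false ∷ T) = s≤s (∣∪∣-≤ S T)
∣∪∣-≤ (true ∷ S) (true ∷ T) =
  s≤s (ℕ.≤-trans (∣∪∣-≤ S T) (ℕ.+-monoʳ-≤ ∣ S ∣ (ℕ.n≤1+n ∣ T ∣)))

-- A `Graph3` may take any value on `triple a a b`, which has fewer than three elements. Clearing
-- these values gives `irrefl`, while `e42` is unchanged because it inspects only 3-sets.
normalise : ∀ {n} → Graph3 n → Graph3 n
normalise G T = (∣ T ∣ ≡ᵇ 3) ∧ G T

e42-normalise : ∀ {n} (G : Graph3 n) → e42 G ≡ e42 (normalise G)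
e42-normalise {n} G = count-cong
  (λ S → cong (λ m → (∣ S ∣ ≡ᵇ 4) ∧ (m ≡ᵇ 2))
    (count-cong (λ T → absorb (∣ T ∣ ≡ᵇ 3) (T ⊆ᵇ S)) (allSubsets n)))
  (allSubsets n)
  where
  absorb : ∀ p q {r} → p ∧ (q ∧ r) ≡ p ∧ (q ∧ (p ∧ r))
  absorb true q = refl
  absorb false q = refl

≡ᵇ-small : ∀ {m} → m ≤ 2 → (m ≡ᵇ 3) ≡ false
≡ᵇ-small {0} _ = refl
≡ᵇ-small {1} _ = refl
≡ᵇ-small {2} _ = refl
≡ᵇ-small {suc (suc (suc m))} (s≤s (s≤s ()))

∣pair∣≤2 : ∀ {n} (a b : Fin n) → ∣ ⁅ a ⁆ ∪ ⁅ b ⁆ ∣ ≤ 2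
∣pair∣≤2 a b = ℕ.≤-trans (∣∪∣-≤ ⁅ a ⁆ ⁅ b ⁆)
  (ℕ.≤-reflexive (cong₂ _+_ (∣⁅x⁆∣≡1 a) (∣⁅x⁆∣≡1 b)))

normalise-isGraph : ∀ {n} (G : Graph3 n) → IsGraph (onTriples (normalise G))
normalise-isGraph G = record
  { swap₁₂ = λ a b c → cong (normalise G) (∪-slide ⁅ a ⁆ ⁅ b ⁆ ⁅ c ⁆)
  ; swap₂₃ = λ a b c → cong (λ S → normalise G (⁅ a ⁆ ∪ S)) (∪-comm ⁅ b ⁆ ⁅ c ⁆)
  ; irrefl = λ a b → cong (_∧ G (triple a a b)) (≡ᵇ-small
      (subst (λ S → ∣ S ∣ ≤ 2)
        (trans (cong (_∪ ⁅ b ⁆) (sym (∪-idem ⁅ a ⁆))) (∪-assoc ⁅ a ⁆ ⁅ a ⁆ ⁅ b ⁆))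
        (∣pair∣≤2 a b)))
  }

∧-true : ∀ {p q} → p ∧ q ≡ true → p ≡ true × q ≡ true
∧-true {true} q = refl , q

module _ {n : ℕ} (G : Graph3 n) where

  private
    E = onTriples (normalise G)
    open IsGraph (normalise-isGraph G)

  edge-distinct : ∀ {a b c} → E a b c ≡ true → a ≢ b × a ≢ c × b ≢ c
  edge-distinct {a} {b} {c} e =
    (λ { refl → not-¬ e (irrefl a c) }) ,
    (λ { refl → not-¬ e (irrefl₁₃ a b) }) ,
    (λ { refl → not-¬ e (irrefl₂₃ b a) })

  edge-true : ∀ {a b c} → E a b c ≡ true → G (triple a b c) ≡ true
  edge-true e = proj₂ (∧-true e)

  -- The five edges together contain all ten pairs, and the entries of an edge are distinct; a
  -- degenerate copy is therefore a genuine one.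
  no-c5 : ¬ Contains G C5 → ∀ a b c d e → c5 E a b c d e ≡ false
  no-c5 noC5 a b c d e = ¬-not λ eq →
    let abc , eq₁ = ∧-true eq
        bcd , eq₂ = ∧-true eq₁
        cde , eq₃ = ∧-true eq₂
        dea , eab = ∧-true eq₃
        a≢b , a≢c , b≢c = edge-distinct abc
        _ , b≢d , c≢d = edge-distinct bcd
        _ , c≢e , d≢e = edge-distinct cde
        _ , d≢a , e≢a = edge-distinct dea
        _ , e≢b , _ = edge-distinct eab
        unique : Unique (a ∷ b ∷ c ∷ d ∷ e ∷ [])
        unique = (a≢b ∷ a≢c ∷ (≢-sym d≢a) ∷ (≢-sym e≢a) ∷ []) ∷ (b≢c ∷ b≢d ∷ (≢-sym e≢b) ∷ [])
               ∷ (c≢d ∷ c≢e ∷ []) ∷ (d≢e ∷ []) ∷ [] ∷ []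
    in noC5 (lookup (a ∷ b ∷ c ∷ d ∷ e ∷ []) , lookup-injective unique _ _ ,
         edge-true abc ∷ edge-true bcd ∷ edge-true cde ∷ edge-true dea ∷ edge-true eab ∷ [])

  no-f32 : ¬ Contains G F32 → ∀ a b c d e → f32 E a b c d e ≡ false
  no-f32 noF32 a b c d e = ¬-not λ eq →
    let abc , eq₁ = ∧-true eq
        abd , eq₂ = ∧-true eq₁
        abe , cde = ∧-true eq₂
        a≢b , a≢c , b≢c = edge-distinct abc
        _ , a≢d , b≢d = edge-distinct abd
        _ , a≢e , b≢e = edge-distinct abe
        c≢d , c≢e , d≢e = edge-distinct cde
        unique : Unique (a ∷ b ∷ c ∷ d ∷ e ∷ [])
        unique = (a≢b ∷ a≢c ∷ a≢d ∷ a≢e ∷ []) ∷ (b≢c ∷ b≢d ∷ b≢e ∷ [])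
               ∷ (c≢d ∷ c≢e ∷ []) ∷ (d≢e ∷ []) ∷ [] ∷ []
    in noF32 (lookup (a ∷ b ∷ c ∷ d ∷ e ∷ []) , lookup-injective unique _ _ ,
         edge-true abc ∷ edge-true abd ∷ edge-true abe ∷ edge-true cde ∷ [])

e42-free : ∀ {n} (G : Graph3 n) → Free G → 16 * (24 * e42 G) ≤ 9 * (n * n * n * n)
e42-free {n} G (noC5 , noF32) = begin
  16 * (24 * e42 G)              ≡⟨ cong (λ m → 16 * (24 * m)) (e42-normalise G) ⟩
  16 * (24 * e42 (normalise G))  ≤⟨ ℕ.*-monoʳ-≤ 16 (e42-≤-∑-twoEdges (normalise G)) ⟩
  16 * ∑⁴ (twoEdges (onTriples (normalise G)))
    ≤⟨ ∑-twoEdges-≤ _ (normalise-isGraph G) (no-c5 G noC5) (no-f32 G noF32) ⟩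
  9 * (n * n * n * n)            ∎
  where open ℕ.≤-Reasoning

-- The blow-up of the complete 3-graph on four vertices

-- The recursion has period four, so that `∑-colour` can peel off one vertex of each colour by
-- computation.
colour : ∀ {n} → Fin n → Fin 4
colour zero = zero
colour (suc zero) = suc zero
colour (suc (suc zero)) = suc (suc zero)
colour (suc (suc (suc zero))) = suc (suc (suc zero))
colour (suc (suc (suc (suc i)))) = colour i

image : ∀ {m n} → (Fin n → Fin m) → Subset n → Subset m
image f [] = ⊥
image f (false ∷ S) = image (f ∘ suc) S
image f (true ∷ S) = ⁅ f zero ⁆ ∪ image (f ∘ suc) S

image-⊥ : ∀ {m n} (f : Fin n → Fin m) → image f ⊥ ≡ ⊥
image-⊥ {n = zero} f = refl
image-⊥ {n = suc n} f = image-⊥ (f ∘ suc)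

image-⁅⁆ : ∀ {m n} (f : Fin n → Fin m) a → image f ⁅ a ⁆ ≡ ⁅ f a ⁆
image-⁅⁆ f zero =
  trans (cong (⁅ f zero ⁆ ∪_) (image-⊥ (f ∘ suc))) (trans (∪-comm ⁅ f zero ⁆ ⊥) (∪-identityˡ ⁅ f zero ⁆))
image-⁅⁆ f (suc a) = image-⁅⁆ (f ∘ suc) a

image-∪ : ∀ {m n} (f : Fin n → Fin m) S T → image f (S ∪ T) ≡ image f S ∪ image f T
image-∪ f [] [] = sym (∪-idem ⊥)
image-∪ f (false ∷ S) (false ∷ T) = image-∪ (f ∘ suc) S T
image-∪ f (true ∷ S) (false ∷ T) =
  trans (cong (⁅ f zero ⁆ ∪_) (image-∪ (f ∘ suc) S T)) (sym (∪-assoc ⁅ f zero ⁆ _ _))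
image-∪ f (false ∷ S) (true ∷ T) =
  trans (cong (⁅ f zero ⁆ ∪_) (image-∪ (f ∘ suc) S T)) (∪-slide ⁅ f zero ⁆ _ _)
image-∪ f (true ∷ S) (true ∷ T) = begin
  v ∪ image g (S ∪ T)                  ≡⟨ cong (v ∪_) (image-∪ g S T) ⟩
  v ∪ (image g S ∪ image g T)          ≡⟨ cong (_∪ (image g S ∪ image g T)) (∪-idem v) ⟨
  (v ∪ v) ∪ (image g S ∪ image g T)    ≡⟨ ∪-assoc v v _ ⟩
  v ∪ (v ∪ (image g S ∪ image g T))    ≡⟨ cong (v ∪_) (∪-slide v (image g S) (image g T)) ⟩
  v ∪ (image g S ∪ (v ∪ image g T))    ≡⟨ ∪-assoc v (image g S) _ ⟨
  (v ∪ image g S) ∪ (v ∪ image g T)    ∎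
  where
  open ≡-Reasoning
  v = ⁅ f zero ⁆
  g = f ∘ suc

rainbow : Triples (Fin 4)
rainbow i j k = ∣ triple i j k ∣ ≡ᵇ 3

-- For a 3-element set, an image of size 3 means three different colours.
blowUp : ∀ {n} → Graph3 n
blowUp T = ∣ image colour T ∣ ≡ᵇ 3

blowUp-triple : ∀ {n} (a b c : Fin n) → blowUp (triple a b c) ≡ rainbow (colour a) (colour b) (colour c)
blowUp-triple a b c = cong (λ S → ∣ S ∣ ≡ᵇ 3) (begin
  image colour (triple a b c)
    ≡⟨ image-∪ colour ⁅ a ⁆ (⁅ b ⁆ ∪ ⁅ c ⁆) ⟩
  image colour ⁅ a ⁆ ∪ image colour (⁅ b ⁆ ∪ ⁅ c ⁆)
    ≡⟨ cong₂ _∪_ (image-⁅⁆ colour a) (image-∪ colour ⁅ b ⁆ ⁅ c ⁆) ⟩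
  ⁅ colour a ⁆ ∪ (image colour ⁅ b ⁆ ∪ image colour ⁅ c ⁆)
    ≡⟨ cong (⁅ colour a ⁆ ∪_) (cong₂ _∪_ (image-⁅⁆ colour b) (image-⁅⁆ colour c)) ⟩
  triple (colour a) (colour b) (colour c) ∎)
  where open ≡-Reasoning

-- The decision runs through all colour tuples, repetitions included: five vertices in four classes
-- always repeat a colour.
rainbow-no-c5 : ∀ i j k l m → c5 rainbow i j k l m ≡ false
rainbow-no-c5 = toWitness {a? = all? λ i → all? λ j → all? λ k → all? λ l → all? λ m →
  c5 rainbow i j k l m ≟ᵇ false} _

rainbow-no-f32 : ∀ i j k l m → f32 rainbow i j k l m ≡ false
rainbow-no-f32 = toWitness {a? = all? λ i → all? λ j → all? λ k → all? λ l → all? λ m →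
  f32 rainbow i j k l m ≟ᵇ false} _

∧-intro : ∀ {p q} → p ≡ true → q ≡ true → p ∧ q ≡ true
∧-intro refl refl = refl

blowUp-free : ∀ n → Free (blowUp {n})
blowUp-free n = noC5 , noF32
  where
  colours : ∀ (a b c : Fin n) → blowUp (triple a b c) ≡ true →
            rainbow (colour a) (colour b) (colour c) ≡ true
  colours a b c e = trans (sym (blowUp-triple a b c)) e
  noC5 : ¬ Contains (blowUp {n}) C5
  noC5 (f , _ , e₁ ∷ e₂ ∷ e₃ ∷ e₄ ∷ e₅ ∷ []) = not-¬
    (∧-intro (colours (f v1) (f v2) (f v3) e₁) (∧-intro (colours (f v2) (f v3) (f v4) e₂)
      (∧-intro (colours (f v3) (f v4) (f v5) e₃) (∧-intro (colours (f v4) (f v5) (f v1) e₄) (colours (f v5) (f v1) (f v2) e₅)))))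
    (rainbow-no-c5 (colour (f v1)) (colour (f v2)) (colour (f v3)) (colour (f v4)) (colour (f v5)))
  noF32 : ¬ Contains (blowUp {n}) F32
  noF32 (f , _ , e₁ ∷ e₂ ∷ e₃ ∷ e₄ ∷ []) = not-¬
    (∧-intro (colours (f v1) (f v2) (f v3) e₁) (∧-intro (colours (f v1) (f v2) (f v4) e₂)
      (∧-intro (colours (f v1) (f v2) (f v5) e₃) (colours (f v3) (f v4) (f v5) e₄))))
    (rainbow-no-f32 (colour (f v1)) (colour (f v2)) (colour (f v3)) (colour (f v4)) (colour (f v5)))

-- The vertices contain `q` blocks with one vertex of each colour; the `r` left over can only
-- increase the sum.
∑-colour : ∀ q r {n} → n ≡ q * 4 + r → (h : Fin 4 → ℕ) → q * ∑ h ≤ ∑ {n} (h ∘ colour)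
∑-colour zero r eq h = z≤n
∑-colour (suc q) r refl h = begin
  ∑ h + q * ∑ h
    ≤⟨ ℕ.+-monoʳ-≤ (∑ h) (∑-colour q r refl h) ⟩
  ∑ h + ∑ {q * 4 + r} (h ∘ colour)
    ≡⟨ rearrange (h zero) (h (suc zero)) (h (suc (suc zero))) (h (suc (suc (suc zero)))) _ ⟩
  ∑ {suc q * 4 + r} (h ∘ colour) ∎
  where
  open ℕ.≤-Reasoning
  rearrange : ∀ x y z w s → x + (y + (z + (w + 0))) + s ≡ x + (y + (z + (w + s)))
  rearrange = solve-∀

module _ {q r n : ℕ} (n≡ : n ≡ q * 4 + r) where

  ∑-colour-step : ∀ p {s g : Fin 4 → ℕ} → (∀ i → p * s i ≤ g i) → q * p * ∑ s ≤ ∑ {n} (g ∘ colour)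
  ∑-colour-step p {s} {g} ps≤g = begin
    q * p * ∑ s               ≡⟨ ℕ.*-assoc q p (∑ s) ⟩
    q * (p * ∑ s)             ≡⟨ cong (q *_) (ℕΣ.*-distribˡ-sum {4} p s) ⟩
    q * ∑ (λ i → p * s i)     ≤⟨ ℕ.*-monoʳ-≤ q (∑-mono {4} ps≤g) ⟩
    q * ∑ g                   ≤⟨ ∑-colour q r n≡ g ⟩
    ∑ {n} (g ∘ colour)        ∎
    where open ℕ.≤-Reasoning

  -- Four colours span exactly two rainbow triples when precisely one pair agrees and three colours
  -- occur: 6 · 4 · 3 · 2 = 144 of the 256 colour quadruples, a proportion of 9/16.
  blowUp-twos : q * (q * (q * (q * 1))) * 144 ≤ ∑⁴ (twoEdges (onTriples (blowUp {n})))
  blowUp-twos = subst (q * (q * (q * (q * 1))) * 144 ≤_) (∑⁴-cong recolour)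
    (∑-colour-step (q * (q * (q * 1))) λ i → ∑-colour-step (q * (q * 1)) λ j →
      ∑-colour-step (q * 1) λ k → ∑-colour-step 1 {s = twoEdges rainbow i j k} λ l →
        ℕ.≤-reflexive (ℕ.*-identityˡ _))
    where
    recolour : ∀ a b c d → twoEdges rainbow (colour a) (colour b) (colour c) (colour d) ≡
               twoEdges (onTriples (blowUp {n})) a b c d
    recolour a b c d
      rewrite blowUp-triple a b c | blowUp-triple a b d | blowUp-triple a c d | blowUp-triple b c d = refl

-- Asymptotics of the binomial coefficient

binomial₂ : ∀ n → n * n ≤ 2 * (n C 2) + n
binomial₂ zero = z≤n
binomial₂ (suc n) = begin
  suc n * suc n                      ≡⟨ expand n ⟩
  n * n + (2 * n + 1)                ≤⟨ ℕ.+-monoˡ-≤ _ (binomial₂ n) ⟩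
  2 * (n C 2) + n + (2 * n + 1)      ≡⟨ collect (n C 2) n ⟩
  2 * (n + n C 2) + suc n            ≡⟨ cong (λ m → 2 * (m + n C 2) + suc n) (nC1≡n n) ⟨
  2 * (n C 1 + n C 2) + suc n        ≡⟨ cong (λ m → 2 * m + suc n) (nCk+nC[k+1]≡[n+1]C[k+1] n 1) ⟩
  2 * (suc n C 2) + suc n            ∎
  where
  open ℕ.≤-Reasoning
  expand : ∀ n → suc n * suc n ≡ n * n + (2 * n + 1)
  expand = solve-∀
  collect : ∀ c n → 2 * c + n + (2 * n + 1) ≡ 2 * (n + c) + suc n
  collect = solve-∀

binomial₃ : ∀ n → n * n * n ≤ 6 * (n C 3) + 3 * (n * n)
binomial₃ zero = z≤n
binomial₃ (suc n) = begin
  suc n * suc n * suc n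
    ≡⟨ expand n ⟩
  n * n * n + 3 * (n * n) + (3 * n + 1)
    ≤⟨ ℕ.+-monoˡ-≤ _ (ℕ.+-mono-≤ (binomial₃ n) (ℕ.*-monoʳ-≤ 3 (binomial₂ n))) ⟩
  6 * (n C 3) + 3 * (n * n) + 3 * (2 * (n C 2) + n) + (3 * n + 1)
    ≤⟨ ℕ.m≤m+n _ 2 ⟩
  6 * (n C 3) + 3 * (n * n) + 3 * (2 * (n C 2) + n) + (3 * n + 1) + 2
    ≡⟨ collect (n C 2) (n C 3) n ⟩
  6 * (n C 2 + n C 3) + 3 * (suc n * suc n)
    ≡⟨ cong (λ m → 6 * m + 3 * (suc n * suc n)) (nCk+nC[k+1]≡[n+1]C[k+1] n 2) ⟩
  6 * (suc n C 3) + 3 * (suc n * suc n) ∎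
  where
  open ℕ.≤-Reasoning
  expand : ∀ n → suc n * suc n * suc n ≡ n * n * n + 3 * (n * n) + (3 * n + 1)
  expand = solve-∀
  collect : ∀ c d n → 6 * d + 3 * (n * n) + 3 * (2 * c + n) + (3 * n + 1) + 2
                      ≡ 6 * (c + d) + 3 * (suc n * suc n)
  collect = solve-∀

binomial₄ : ∀ n → n * n * n * n ≤ 24 * (n C 4) + 6 * (n * n * n)
binomial₄ zero = z≤n
binomial₄ (suc n) = begin
  suc n * suc n * suc n * suc n
    ≡⟨ expand n ⟩
  n * n * n * n + 4 * (n * n * n) + (6 * (n * n) + 4 * n + 1)
    ≤⟨ ℕ.+-monoˡ-≤ _ (ℕ.+-mono-≤ (binomial₄ n) (ℕ.*-monoʳ-≤ 4 (binomial₃ n))) ⟩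
  24 * (n C 4) + 6 * (n * n * n) + 4 * (6 * (n C 3) + 3 * (n * n)) + (6 * (n * n) + 4 * n + 1)
    -- Padding: the amount by which `6 * (suc n * suc n * suc n)` exceeds the lower-order terms
    -- gathered so far.
    ≤⟨ ℕ.m≤m+n _ (14 * n + 5) ⟩
  24 * (n C 4) + 6 * (n * n * n) + 4 * (6 * (n C 3) + 3 * (n * n)) + (6 * (n * n) + 4 * n + 1) + (14 * n + 5)
    ≡⟨ collect (n C 3) (n C 4) n ⟩
  24 * (n C 3 + n C 4) + 6 * (suc n * suc n * suc n)
    ≡⟨ cong (λ m → 24 * m + 6 * (suc n * suc n * suc n)) (nCk+nC[k+1]≡[n+1]C[k+1] n 3) ⟩
  24 * (suc n C 4) + 6 * (suc n * suc n * suc n) ∎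
  where
  open ℕ.≤-Reasoning
  expand : ∀ n → suc n * suc n * suc n * suc n
                 ≡ n * n * n * n + 4 * (n * n * n) + (6 * (n * n) + 4 * n + 1)
  expand = solve-∀
  collect : ∀ c d n → 24 * d + 6 * (n * n * n) + 4 * (6 * c + 3 * (n * n)) + (6 * (n * n) + 4 * n + 1) + (14 * n + 5)
                      ≡ 24 * (c + d) + 6 * (suc n * suc n * suc n)
  collect = solve-∀

-- n⁴ - x⁴ = r (n³ + n²x + nx² + x³) for n = x + r.
fourth-power : ∀ x {r} → r ≤ 3 → let n = x + r in
               n * n * n * n ≤ x * x * x * x + 12 * (n * n * n)
fourth-power x {r} r≤3 = begin
  n * n * n * n
    ≡⟨ factor x r ⟩
  x * x * x * x + r * (n * n * n + n * n * x + n * x * x + x * x * x)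
    ≤⟨ ℕ.+-monoʳ-≤ (x * x * x * x) (ℕ.*-mono-≤ r≤3 (ℕ.+-mono-≤ (ℕ.+-mono-≤
         (ℕ.+-monoʳ-≤ (n * n * n) (ℕ.*-monoʳ-≤ (n * n) x≤n))
         (ℕ.*-mono-≤ (ℕ.*-monoʳ-≤ n x≤n) x≤n)) (ℕ.*-mono-≤ (ℕ.*-mono-≤ x≤n x≤n) x≤n))) ⟩
  x * x * x * x + 3 * (n * n * n + n * n * n + n * n * n + n * n * n)
    ≡⟨ cong (_+_ (x * x * x * x)) (collect (n * n * n)) ⟩
  x * x * x * x + 12 * (n * n * n) ∎
  where
  open ℕ.≤-Reasoning
  n = x + r
  x≤n : x ≤ n
  x≤n = ℕ.m≤m+n x r
  factor : ∀ x r → (x + r) * (x + r) * (x + r) * (x + r) ≡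
    x * x * x * x + r * ((x + r) * (x + r) * (x + r) + (x + r) * (x + r) * x + (x + r) * x * x + x * x * x)
  factor = solve-∀
  collect : ∀ m → 3 * (m + m + m + m) ≡ 12 * m
  collect = solve-∀

e42-blowUp : ∀ n → 9 * (n * n * n * n) + 16 * (24 * (n C 4)) ≤
                   16 * (24 * e42 (blowUp {n})) + 16 * (n * n * n * n) + 108 * (n * n * n)
e42-blowUp n = begin
  9 * (n * n * n * n) + 16 * c
    ≤⟨ ℕ.+-monoˡ-≤ (16 * c) (ℕ.*-monoʳ-≤ 9 power) ⟩
  9 * (x * x * x * x + 12 * (n * n * n)) + 16 * c
    -- With `x = q * 4`, the identity 9 · 256 = 16 · 144 matches the fourth power to `blowUp-twos`;
    -- 108 is 9 · 12.
    ≡⟨ unscale q (n * n * n) c ⟩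
  16 * (q * (q * (q * (q * 1))) * 144 + c) + 108 * (n * n * n)
    ≤⟨ ℕ.+-monoˡ-≤ (108 * (n * n * n)) (ℕ.*-monoʳ-≤ 16 (ℕ.≤-trans
         (ℕ.+-monoˡ-≤ c (blowUp-twos {q} {r} n≡)) (∑-twoEdges-≤-e42 (blowUp {n})))) ⟩
  16 * (24 * e42 (blowUp {n}) + n * n * n * n) + 108 * (n * n * n)
    ≡⟨ cong (_+ 108 * (n * n * n)) (ℕ.*-distribˡ-+ 16 (24 * e42 (blowUp {n})) (n * n * n * n)) ⟩
  16 * (24 * e42 (blowUp {n})) + 16 * (n * n * n * n) + 108 * (n * n * n) ∎
  where
  open ℕ.≤-Reasoning
  c = 24 * (n C 4)
  q = n / 4
  r = n % 4
  x = q * 4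
  n≡ : n ≡ x + r
  n≡ = trans (m≡m%n+[m/n]*n n 4) (ℕ.+-comm r x)
  power : n * n * n * n ≤ x * x * x * x + 12 * (n * n * n)
  power = subst (λ m → m * m * m * m ≤ x * x * x * x + 12 * (m * m * m)) (sym n≡)
    (fourth-power x (s≤s⁻¹ (m%n<n n 4)))
  unscale : ∀ q m c → 9 * (q * 4 * (q * 4) * (q * 4) * (q * 4) + 12 * m) + 16 * c
                      ≡ 16 * (q * (q * (q * (q * 1))) * 144 + c) + 108 * m
  unscale = solve-∀

-- Absorbing the cubic errors

-- The 6 pays for the error in `binomial₄`. The factor 10 suits both bounds: `lower` has a cubic
-- error of 150 `K` against an allowance of 16, and 10 is the least integer whose product with 16
-- reaches 150.
cube-negligible : ∀ K n → 10 * K + 6 ≤ n → 10 * K * (n * n * n) ≤ 24 * (n C 4)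
cube-negligible K n N≤n = ℕ.+-cancelʳ-≤ (6 * (n * n * n)) _ _ (begin
  10 * K * (n * n * n) + 6 * (n * n * n)    ≡⟨ ℕ.*-distribʳ-+ (n * n * n) (10 * K) 6 ⟨
  (10 * K + 6) * (n * n * n)                ≤⟨ ℕ.*-monoˡ-≤ (n * n * n) N≤n ⟩
  n * (n * n * n)                           ≡⟨ ℕ.*-comm n (n * n * n) ⟩
  n * n * n * n                             ≤⟨ binomial₄ n ⟩
  24 * (n C 4) + 6 * (n * n * n)            ∎)
  where open ℕ.≤-Reasoning

module _ (K n : ℕ) (N≤n : 10 * K + 6 ≤ n) where

  private
    C₄ n³ n⁴ : ℕ
    C₄ = n C 4
    n³ = n * n * n
    n⁴ = n * n * n * n

    cubes : ∀ m {k} → m ≡ k * 10 → m * (K * n³) ≤ k * (24 * C₄)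
    cubes m {k} m≡ = begin
      m * (K * n³)         ≡⟨ cong (_* (K * n³)) m≡ ⟩
      k * 10 * (K * n³)    ≡⟨ regroup k K n³ ⟩
      k * (10 * K * n³)    ≤⟨ ℕ.*-monoʳ-≤ k (cube-negligible K n N≤n) ⟩
      k * (24 * C₄)        ∎
      where
      open ℕ.≤-Reasoning
      regroup : ∀ k K m → k * 10 * (K * m) ≡ k * (10 * K * m)
      regroup = solve-∀

  upper : ∀ e → 16 * (24 * e) ≤ 9 * n⁴ → 16 * K * e ≤ (9 * K + 16) * C₄
  upper e bound = ℕ.*-cancelˡ-≤ 24 (begin
    24 * (16 * K * e)                          ≡⟨ regroup K e ⟩
    K * (16 * (24 * e))                        ≤⟨ ℕ.*-monoʳ-≤ K bound ⟩
    K * (9 * n⁴)                               ≤⟨ ℕ.*-monoʳ-≤ K (ℕ.*-monoʳ-≤ 9 (binomial₄ n)) ⟩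
    -- The cubic error 9 · 6 = 54 is padded by 106 to 160 = 16 · 10, the form taken by `cubes`.
    K * (9 * (24 * C₄ + 6 * n³))               ≤⟨ ℕ.m≤m+n _ (106 * (K * n³)) ⟩
    K * (9 * (24 * C₄ + 6 * n³)) + 106 * (K * n³) ≡⟨ collect K C₄ n³ ⟩
    24 * (9 * K * C₄) + 160 * (K * n³)         ≤⟨ ℕ.+-monoʳ-≤ (24 * (9 * K * C₄)) (cubes 160 {16} refl) ⟩
    24 * (9 * K * C₄) + 16 * (24 * C₄)         ≡⟨ factor K C₄ ⟩
    24 * ((9 * K + 16) * C₄)                   ∎)
    where
    open ℕ.≤-Reasoning
    regroup : ∀ K e → 24 * (16 * K * e) ≡ K * (16 * (24 * e))
    regroup = solve-∀
    collect : ∀ K c m → K * (9 * (24 * c + 6 * m)) + 106 * (K * m) ≡ 24 * (9 * K * c) + 160 * (K * m)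
    collect = solve-∀
    factor : ∀ K c → 24 * (9 * K * c) + 16 * (24 * c) ≡ 24 * ((9 * K + 16) * c)
    factor = solve-∀

  lower : ∀ e → 9 * n⁴ + 16 * (24 * C₄) ≤ 16 * (24 * e) + 16 * n⁴ + 108 * n³ →
          9 * K * C₄ ≤ 16 * K * e + 16 * C₄
  -- The surplus 16 - 9 = 7 of fourth powers on the right is traded for binomials by `binomial₄`,
  -- costing 7 · 6 = 42 cubes; with the given 108 this makes 150.
  lower e bound = ℕ.*-cancelˡ-≤ 24 (ℕ.+-cancelʳ-≤ (K * (9 * n⁴ + 7 * (24 * C₄))) _ _ (begin
    24 * (9 * K * C₄) + K * (9 * n⁴ + 7 * (24 * C₄))
      ≡⟨ regroup K C₄ n⁴ ⟩
    K * (9 * n⁴ + 16 * (24 * C₄))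
      ≤⟨ ℕ.*-monoʳ-≤ K bound ⟩
    K * (16 * (24 * e) + 16 * n⁴ + 108 * n³)
      ≡⟨ split K e n⁴ n³ ⟩
    K * (16 * (24 * e) + 9 * n⁴ + 108 * n³) + 7 * K * n⁴
      ≤⟨ ℕ.+-monoʳ-≤ (K * (16 * (24 * e) + 9 * n⁴ + 108 * n³)) (ℕ.*-monoʳ-≤ (7 * K) (binomial₄ n)) ⟩
    K * (16 * (24 * e) + 9 * n⁴ + 108 * n³) + 7 * K * (24 * C₄ + 6 * n³)
      ≡⟨ collect K e n⁴ n³ C₄ ⟩
    24 * (16 * K * e) + 150 * (K * n³) + K * (9 * n⁴ + 7 * (24 * C₄))
      ≤⟨ ℕ.+-monoˡ-≤ (K * (9 * n⁴ + 7 * (24 * C₄))) (ℕ.+-monoʳ-≤ (24 * (16 * K * e))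
           (ℕ.≤-trans (cubes 150 {15} refl) (ℕ.*-monoˡ-≤ (24 * C₄) (ℕ.n≤1+n 15)))) ⟩
    24 * (16 * K * e) + 16 * (24 * C₄) + K * (9 * n⁴ + 7 * (24 * C₄))
      ≡⟨ cong (_+ K * (9 * n⁴ + 7 * (24 * C₄))) (factor K e C₄) ⟩
    24 * (16 * K * e + 16 * C₄) + K * (9 * n⁴ + 7 * (24 * C₄)) ∎))
    where
    open ℕ.≤-Reasoning
    regroup : ∀ K c p → 24 * (9 * K * c) + K * (9 * p + 7 * (24 * c)) ≡ K * (9 * p + 16 * (24 * c))
    regroup = solve-∀
    split : ∀ K e p m → K * (16 * (24 * e) + 16 * p + 108 * m) ≡
                        K * (16 * (24 * e) + 9 * p + 108 * m) + 7 * K * p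
    split = solve-∀
    collect : ∀ K e p m c → K * (16 * (24 * e) + 9 * p + 108 * m) + 7 * K * (24 * c + 6 * m) ≡
                            24 * (16 * K * e) + 150 * (K * m) + K * (9 * p + 7 * (24 * c))
    collect = solve-∀
    factor : ∀ K e c → 24 * (16 * K * e) + 16 * (24 * c) ≡ 24 * (16 * K * e + 16 * c)
    factor = solve-∀

theorem2p10 : (k : ℕ) → ∃[ N ] ((n : ℕ) → N ≤ n →
    ((G : Graph3 n) → Free G → 16 * suc k * e42 G ≤ (9 * suc k + 16) * (n C 4))
    × Σ[ G ∈ Graph3 n ] (Free G × 9 * suc k * (n C 4) ≤ 16 * suc k * e42 G + 16 * (n C 4)))
-- Dividing both inequalities by `16 * suc k * (n C 4)` places the maximal density within
-- `1 / suc k` of 9/16 for every such `n`.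
theorem2p10 k = 10 * suc k + 6 , λ n N≤n →
  (λ G free → upper (suc k) n N≤n (e42 G) (e42-free G free)) ,
  blowUp , blowUp-free n , lower (suc k) n N≤n (e42 (blowUp {n})) (e42-blowUp n)
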